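{- Let $H$ be a finite graph without multiple edges, possibly with loops, with no isolated vertices, and with maximum degree $\Delta$ (loops counting once toward the degree). Suppose that either (i) $H \neq K_{\Delta}^{\text{loop}}$ and $H$ has a looped dominating vertex, or (ii) $\hom(K_2,H) = \sum_{v \in V(H)} d(v) < \Delta^2$ and $H$ has a unique vertex of degree $\Delta$. Then there exists a constant $c_H$, depending only on $H$, such that for every integer $\delta \ge 1$, all $n \geq c_H \delta^2$ and all $G \in \mathcal{G}(n,\delta)$, \[ \hom(G,H) \leq \hom(K_{\delta,n-\delta},H), \] with equality only for $G=K_{\delta,n-\delta}$.
   Context: For a finite simple (loopless) graph $G$ and a finite graph $H$ (no multiple edges, loops allowed), $\hom(G,H)$ is the number of maps $f:V(G)\to V(H)$ such that $v\sim_G w$ implies $f(v)\sim_H f(w)$. For $v\in V(H)$, $d(v)$ is the degree of $v$, where a loop counts once; $\Delta=\max_{v\in V(H)} d(v)$. A vertex of $H$ is isolated if it is incident to no edge and no loop. A looped dominating vertex of $H$ is a vertex adjacent to every vertex of $H$, including itself. $K_\Delta^{\text{loop}}$ is the fully looped complete graph on $\Delta$ vertices. $\mathcal{G}(n,\delta)$ is the set of all $n$-vertex finite simple graphs with minimum degree (exactly) $\delta$. $K_{a,b}$ is the complete bipartite graph with parts of sizes $a$ and $b$. Graph equality is up to isomorphism. -}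

module Defs where

open import Data.Empty using (⊥)
open import Data.Fin using (Fin; splitAt; finToFun)
open import Data.Fin.Permutation using (Permutation; _⟨$⟩ʳ_)
open import Data.Fin.Properties using (_≟_; all?)
open import Data.List using (length; filter; map; allFin)
open import Data.List.Extrema.Nat using (max)
open import Data.Nat using (ℕ; _+_; _≤_; _<_; _^_)
open import Data.Product using (∃; ∃!; ∃-syntax; _×_)
open import Data.Sum using (_⊎_; inj₁; inj₂)
open import Data.Unit using (⊤; tt)
open import Function.Bundles using (_⇔_)
open import Level using (0ℓ)
open import Relation.Binary.Core using (Rel)
open import Relation.Binary.Definitions using (Symmetric; Irreflexive) renaming (Decidable to Decidable₂)
open import Relation.Binary.PropositionalEquality using (_≡_; _≢_; refl; ≢-sym)
open import Relation.Nullary using (¬_; yes; no; ¬?; _→-dec_)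
open import Relation.Unary using (Pred; Decidable)

-- Loops are allowed.  An edge relation cannot record multiple edges.
record Graph (n : ℕ) : Set₁ where
  field
    _~_   : Rel (Fin n) 0ℓ
    ~-sym : Symmetric _~_
    _~?_  : Decidable₂ _~_

record SimpleGraph (n : ℕ) : Set₁ where
  field
    graph    : Graph n
  open Graph graph public
  field
    loopless : Irreflexive _≡_ _~_

open SimpleGraph using (graph)

infix 4 _≅_

_≅_ : ∀ {m n} → Graph m → Graph n → Set
_≅_ {m} {n} G H = ∃[ π ] (∀ v w → (v G.~ w) ⇔ ((π ⟨$⟩ʳ v) H.~ (π ⟨$⟩ʳ w)))
  where
  module G = Graph G
  module H = Graph H

count : ∀ {n} {P : Pred (Fin n) 0ℓ} → Decidable P → ℕ
count {n} P? = length (filter P? (allFin n))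

module _ {n : ℕ} (G : Graph n) where
  open Graph G

  -- A loop at v contributes v itself to the neighbours of v, hence counts once.
  degree : Fin n → ℕ
  degree v = count (v ~?_)

  -- The base value 0 matters only for the graph with no vertices.
  maxDegree : ℕ
  maxDegree = max 0 (map degree (allFin n))

  MinDegree : ℕ → Set
  MinDegree δ = (∀ v → δ ≤ degree v) × ∃[ v ] degree v ≡ δ

  Isolated : Fin n → Set
  Isolated v = ∀ w → ¬ (v ~ w)

  LoopedDominating : Fin n → Set
  LoopedDominating v = ∀ w → v ~ w

module _ {n k : ℕ} (G : SimpleGraph n) (H : Graph k) where
  private
    module G = SimpleGraph G
    module H = Graph H

  IsHom : (Fin n → Fin k) → Set
  IsHom f = ∀ v w → v G.~ w → f v H.~ f w

  isHom? : Decidable IsHom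
  isHom? f = all? λ v → all? λ w → (v G.~? w) →-dec (f v H.~? f w)

  -- finToFun is a bijection from Fin (k ^ n) to the maps Fin n → Fin k.
  hom : ℕ
  hom = count {k ^ n} λ i → isHom? (finToFun i)

K : ∀ n → SimpleGraph n
K n = record
  { graph    = record
    { _~_   = _≢_
    ; ~-sym = ≢-sym
    ; _~?_  = λ v w → ¬? (v ≟ w)
    }
  ; loopless = λ v≡w v≢w → v≢w v≡w
  }

Kˡᵒᵒᵖ : ∀ n → Graph n
Kˡᵒᵒᵖ n = record
  { _~_   = λ _ _ → ⊤
  ; ~-sym = λ _ → tt
  ; _~?_  = λ _ _ → yes tt
  }

OppositeSides : ∀ {A B : Set} → Rel (A ⊎ B) 0ℓ
OppositeSides (inj₁ _) (inj₁ _) = ⊥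
OppositeSides (inj₁ _) (inj₂ _) = ⊤
OppositeSides (inj₂ _) (inj₁ _) = ⊤
OppositeSides (inj₂ _) (inj₂ _) = ⊥

private
  opposite-sym : ∀ {A B : Set} (x y : A ⊎ B) → OppositeSides x y → OppositeSides y x
  opposite-sym (inj₁ _) (inj₂ _) _ = tt
  opposite-sym (inj₂ _) (inj₁ _) _ = tt

  opposite? : ∀ {A B : Set} → Decidable₂ (OppositeSides {A} {B})
  opposite? (inj₁ _) (inj₁ _) = no λ ()
  opposite? (inj₁ _) (inj₂ _) = yes tt
  opposite? (inj₂ _) (inj₁ _) = yes tt
  opposite? (inj₂ _) (inj₂ _) = no λ ()

  opposite-irrefl : ∀ {A B : Set} (x : A ⊎ B) → ¬ OppositeSides x x
  opposite-irrefl (inj₁ _) ()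
  opposite-irrefl (inj₂ _) ()

-- The parts are the first a and the last b elements of Fin (a + b).
K⟨_,_⟩ : ∀ a b → SimpleGraph (a + b)
K⟨ a , b ⟩ = record
  { graph    = record
    { _~_   = λ v w → OppositeSides (splitAt a v) (splitAt a w)
    ; ~-sym = λ {v} {w} → opposite-sym (splitAt a v) (splitAt a w)
    ; _~?_  = λ v w → opposite? (splitAt a v) (splitAt a w)
    }
  ; loopless = λ { {v} refl → opposite-irrefl (splitAt a v) }
  }

{-# OPTIONS --safe #-}
-- Let Δ be the maximum degree of H, s the sum of its degrees and D the set of its vertices of degree Δ.  Either
-- hypothesis gives s < Δ² and makes all vertices of D have the same neighbourhood, so hom(K_{δ,n-δ}, H) ≥ |D|^δ Δ^(n-δ).
-- Colour G in an order in which each new vertex has a coloured neighbour (at most Δ choices), or a new edge is coloured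
-- at once (at most s choices).  If G has m = O(δ) disjoint edges, starting with these gives s^m Δ^(n-2m) < Δ^(n-δ)
-- colourings.  Otherwise G has a vertex cover of size O(δ), and for n ≥ cδ² some vertex has only neighbours of degree at
-- least T = O(δ).  Let L consist of δ of these neighbours.  A colouring putting a vertex of L outside D leaves at most
-- Δ - 1 choices to each of its T neighbours, so such colourings are negligible.  If some edge avoids L, the colourings
-- with L coloured in D number at most |D|^δ s Δ^(n-δ-2).  If no edge avoids L, the minimum degree makes G contain the
-- biclique between L and its complement, and an edge inside L loses a colouring since the neighbourhood of a vertex of
-- D is not a looped clique.
module Submission where

open import Defs
open import Data.Fin using (Fin; zero; suc; combine; finToFun; funToFin; join; splitAt; _↑ˡ_; _↑ʳ_)
open import Data.Fin.Permutation as Perm using (Permutation; permutation; _⟨$⟩ʳ_; _⟨$⟩ˡ_)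
open import Data.Fin.Properties
  using (all?; any?; finToFun-funToFin; funToFin-finToFin; join-splitAt; remQuot-combine; splitAt-join)
import Data.Fin.Properties as Fin
open import Data.List using (List; []; _∷_; _++_; allFin; concatMap; filter; length; map; tabulate; take)
import Data.List as List
open import Data.List.Extrema.Nat using (max≤v⁺; xs≤max)
open import Data.List.Membership.DecPropositional using (_∈?_)
open import Data.List.Membership.Propositional using (_∈_; _∉_)
open import Data.List.Membership.Propositional.Properties
open import Data.List.Properties
  using (filter-all; filter-notAll; length-++; length-filter; length-map; length-tabulate; length-take)
open import Data.List.Relation.Unary.All as All using (All; []; _∷_)
import Data.List.Relation.Unary.All.Properties as All
open import Data.List.Relation.Unary.AllPairs using ([]; _∷_)
open import Data.List.Relation.Unary.Any as Any using (here; there)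
open import Data.List.Relation.Unary.Any.Properties using (lookup-index)
open import Data.List.Relation.Unary.Unique.Propositional using (Unique)
import Data.List.Relation.Unary.Unique.Propositional.Properties as Unique
open import Data.Nat
open import Data.Nat.Properties
open import Data.Nat.Tactic.RingSolver using (solve-∀)
open import Data.Product using (_×_; _,_; ∃!; ∃-syntax; proj₁; proj₂)
open import Data.Sum using (_⊎_; inj₁; inj₂; [_,_]′)
open import Data.Unit using (⊤; tt)
open import Data.Vec using (Vec; []; _∷_; lookup; _[_]≔_)
import Data.Vec as Vec
open import Data.Vec.Properties using (lookup-replicate; lookup-splitAt; lookup∘update; lookup∘update′)
open import Function using (_∘_; id; Injective)
open import Function.Bundles using (mk⇔)
open import Level using (0ℓ)
open import Relation.Binary.PropositionalEquality
open import Relation.Nullary using (¬_; Dec; yes; no; contradiction; decidable-stable; ¬?; _×-dec_; _→-dec_)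
open import Relation.Nullary.Decidable using (map′)
open import Relation.Unary using (Decidable; Pred)

open import Algebra.Properties.Semiring.Sum +-*-semiring
  using (sum; sum-cong-≗; ∑-comm; ∑-distrib-+; *-distribˡ-sum; *-distribʳ-sum)

-- Sums over colourings

⟦_⟧ : ∀ {A : Set} → Dec A → ℕ
⟦ yes _ ⟧ = 1
⟦ no  _ ⟧ = 0

⟦⟧-mono : ∀ {A B : Set} (A? : Dec A) (B? : Dec B) → (A → B) → ⟦ A? ⟧ ≤ ⟦ B? ⟧
⟦⟧-mono (yes a) (yes _) f = ≤-refl
⟦⟧-mono (yes a) (no ¬b) f = contradiction (f a) ¬b
⟦⟧-mono (no _)  B?      f = z≤n

⟦⟧-holds : ∀ {A : Set} (A? : Dec A) → A → 1 ≤ ⟦ A? ⟧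
⟦⟧-holds (yes _) a = ≤-refl
⟦⟧-holds (no ¬a) a = contradiction a ¬a

⟦⟧-fails : ∀ {A : Set} (A? : Dec A) → ¬ A → ⟦ A? ⟧ ≡ 0
⟦⟧-fails (yes a) ¬a = contradiction a ¬a
⟦⟧-fails (no _)  ¬a = refl

sum-mono : ∀ {n} {f g : Fin n → ℕ} → (∀ i → f i ≤ g i) → sum f ≤ sum g
sum-mono {zero}  f≤g = z≤n
sum-mono {suc n} f≤g = +-mono-≤ (f≤g zero) (sum-mono (f≤g ∘ suc))

sum-const : ∀ n {c} → sum {n} (λ _ → c) ≡ n * c
sum-const zero    = refl
sum-const (suc n) = cong (_ +_) (sum-const n)

sum-++ : ∀ m {n} (f : Fin (m + n) → ℕ) →
         sum f ≡ sum (λ i → f (i ↑ˡ n)) + sum (λ j → f (m ↑ʳ j))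
sum-++ zero    f = refl
sum-++ (suc m) f =
  trans (cong (f zero +_) (sum-++ m (f ∘ suc))) (sym (+-assoc (f zero) _ _))

sum-combine : ∀ m {n} (f : Fin (m * n) → ℕ) →
              sum f ≡ sum {m} (λ i → sum {n} (λ j → f (combine i j)))
sum-combine zero        f = refl
sum-combine (suc m) {n} f =
  trans (sum-++ n f) (cong (sum (λ j → f (j ↑ˡ (m * n))) +_) (sum-combine m (λ i → f (n ↑ʳ i))))

count≡sum : ∀ {n} {P : Pred (Fin n) 0ℓ} (P? : Decidable P) →
            count P? ≡ sum (λ i → ⟦ P? i ⟧)
count≡sum P? = filter-tabulate P? id
  where
  filter-tabulate : ∀ {m n} {P : Pred (Fin m) 0ℓ} (P? : Decidable P) (g : Fin n → Fin m) →
                    length (filter P? (tabulate g)) ≡ sum (λ i → ⟦ P? (g i) ⟧)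
  filter-tabulate {n = zero}  P? g = refl
  filter-tabulate {n = suc n} P? g with P? (g zero)
  ... | yes _ = cong suc (filter-tabulate P? (g ∘ suc))
  ... | no  _ = filter-tabulate P? (g ∘ suc)

module _ {k : ℕ} where

  ∑ : ∀ {n} → (Vec (Fin k) n → ℕ) → ℕ
  ∑ {zero}  F = F []
  ∑ {suc n} F = sum λ x → ∑ λ f → F (x ∷ f)

  # : ∀ {n} {P : Pred (Vec (Fin k) n) 0ℓ} → Decidable P → ℕ
  # P? = ∑ λ f → ⟦ P? f ⟧

  ∑-mono : ∀ {n} {F G : Vec (Fin k) n → ℕ} → (∀ f → F f ≤ G f) → ∑ F ≤ ∑ G
  ∑-mono {zero}  F≤G = F≤G []
  ∑-mono {suc n} F≤G = sum-mono λ x → ∑-mono λ f → F≤G (x ∷ f)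

  ∑-cong : ∀ {n} {F G : Vec (Fin k) n → ℕ} → (∀ f → F f ≡ G f) → ∑ F ≡ ∑ G
  ∑-cong {zero}  F≡G = F≡G []
  ∑-cong {suc n} F≡G = sum-cong-≗ λ x → ∑-cong λ f → F≡G (x ∷ f)

  ∑-+ : ∀ {n} (F G : Vec (Fin k) n → ℕ) → ∑ (λ f → F f + G f) ≡ ∑ F + ∑ G
  ∑-+ {zero}  F G = refl
  ∑-+ {suc n} F G = trans (sum-cong-≗ λ x → ∑-+ (F ∘ (x ∷_)) (G ∘ (x ∷_))) (∑-distrib-+ (λ x → ∑ (F ∘ (x ∷_))) (λ x → ∑ (G ∘ (x ∷_))))

  ∑-*ˡ : ∀ {n} c (F : Vec (Fin k) n → ℕ) → c * ∑ F ≡ ∑ (λ f → c * F f)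
  ∑-*ˡ {zero}  c F = refl
  ∑-*ˡ {suc n} c F = trans (*-distribˡ-sum c (λ x → ∑ (F ∘ (x ∷_)))) (sum-cong-≗ λ x → ∑-*ˡ c (F ∘ (x ∷_)))

  ∑-sum : ∀ {n} (F : Fin k → Vec (Fin k) n → ℕ) →
          sum (λ x → ∑ (F x)) ≡ ∑ (λ f → sum (λ x → F x f))
  ∑-sum {zero}  F = refl
  ∑-sum {suc n} F = trans (∑-comm (λ x y → ∑ (λ f → F x (y ∷ f)))) (sum-cong-≗ λ y → ∑-sum (λ x f → F x (y ∷ f)))

  ∑-const : ∀ n {c} → ∑ {n} (λ _ → c) ≡ k ^ n * c
  ∑-const zero        = sym (+-identityʳ _)
  ∑-const (suc n) {c} = begin
    sum {k} (λ _ → ∑ {n} (λ _ → c))  ≡⟨ sum-const k ⟩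
    k * ∑ {n} (λ _ → c)              ≡⟨ cong (k *_) (∑-const n) ⟩
    k * (k ^ n * c)                  ≡⟨ *-assoc k (k ^ n) c ⟨
    k ^ suc n * c                    ∎
    where open ≡-Reasoning

  -- The old colour of `v` is overwritten, so each colouring arises `k` times as some `f [ v ]≔ x`.
  -- This lets a vertex be coloured after others without reordering the coordinates.
  ∑-resample : ∀ {n} (v : Fin n) (F : Vec (Fin k) n → ℕ) →
               k * ∑ F ≡ ∑ (λ f → sum (λ x → F (f [ v ]≔ x)))
  ∑-resample {suc n} zero F = begin
    k * sum (λ x → ∑ (F ∘ (x ∷_)))             ≡⟨ cong (k *_) (∑-sum (λ x f → F (x ∷ f))) ⟩
    k * ∑ (λ f → sum (λ x → F (x ∷ f)))        ≡⟨ sum-const k ⟨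
    sum {k} (λ y → ∑ (λ f → sum (λ x → F (x ∷ f))))  ∎
    where open ≡-Reasoning
  ∑-resample {suc n} (suc v) F = begin
    k * sum (λ x → ∑ (F ∘ (x ∷_)))                      ≡⟨ *-distribˡ-sum k (λ x → ∑ (F ∘ (x ∷_))) ⟩
    sum (λ x → k * ∑ (F ∘ (x ∷_)))                      ≡⟨ sum-cong-≗ (λ x → ∑-resample v (F ∘ (x ∷_))) ⟩
    sum (λ x → ∑ λ f → sum λ y → F (x ∷ (f [ v ]≔ y)))  ∎
    where open ≡-Reasoning

  #-mono : ∀ {n} {P Q : Pred (Vec (Fin k) n) 0ℓ} (P? : Decidable P) (Q? : Decidable Q) →
           (∀ f → P f → Q f) → # P? ≤ # Q?
  #-mono P? Q? P⇒Q = ∑-mono λ f → ⟦⟧-mono (P? f) (Q? f) (P⇒Q f)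

  #-∪ : ∀ {n} {P Q R : Pred (Vec (Fin k) n) 0ℓ} (P? : Decidable P) (Q? : Decidable Q) (R? : Decidable R) →
        (∀ f → P f → Q f ⊎ R f) → # P? ≤ # Q? + # R?
  #-∪ P? Q? R? P⇒Q∪R = ≤-trans (∑-mono pointwise) (≤-reflexive (∑-+ (λ f → ⟦ Q? f ⟧) (λ f → ⟦ R? f ⟧)))
    where
    pointwise : ∀ f → ⟦ P? f ⟧ ≤ ⟦ Q? f ⟧ + ⟦ R? f ⟧
    pointwise f with P? f
    ... | no _  = z≤n
    ... | yes p = [ (λ q → ≤-trans (⟦⟧-holds (Q? f) q) (m≤m+n _ _))
                  , (λ r → ≤-trans (⟦⟧-holds (R? f) r) (m≤n+m _ _)) ]′ (P⇒Q∪R f p)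

  #-product : ∀ a {b} {P : Pred (Vec (Fin k) (a + b)) 0ℓ} (P? : Decidable P)
              {X Y : Pred (Fin k) 0ℓ} (X? : Decidable X) (Y? : Decidable Y) →
              (∀ (f : Vec (Fin k) a) (g : Vec (Fin k) b) →
                (∀ i → X (lookup f i)) → (∀ j → Y (lookup g j)) → P (f Vec.++ g)) →
              count X? ^ a * count Y? ^ b ≤ # P?
  #-product zero {zero} P? X? Y? holds =
    ⟦⟧-holds (P? []) (holds [] [] (λ ()) (λ ()))
  #-product zero {suc b} P? {X} {Y} X? Y? holds = begin
    1 * (count Y? * count Y? ^ b)                 ≡⟨ *-identityˡ _ ⟩
    count Y? * count Y? ^ b                       ≡⟨ cong (_* count Y? ^ b) (count≡sum Y?) ⟩
    sum (λ y → ⟦ Y? y ⟧) * count Y? ^ b           ≡⟨ *-distribʳ-sum (count Y? ^ b) (λ y → ⟦ Y? y ⟧) ⟩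
    sum (λ y → ⟦ Y? y ⟧ * count Y? ^ b)           ≤⟨ sum-mono pointwise ⟩
    sum (λ y → # (P? ∘ (y ∷_)))                   ∎
    where
    open ≤-Reasoning
    pointwise : ∀ y → ⟦ Y? y ⟧ * count Y? ^ b ≤ # (P? ∘ (y ∷_))
    pointwise y with Y? y
    ... | no  _ = z≤n
    ... | yes p = #-product zero (P? ∘ (y ∷_)) X? Y? λ
      { [] g xs ys → holds [] (y ∷ g) (λ ()) (λ { zero → p ; (suc j) → ys j }) }
  #-product (suc a) {b} P? {X} {Y} X? Y? holds = begin
    count X? * count X? ^ a * count Y? ^ b           ≡⟨ *-assoc (count X?) _ _ ⟩
    count X? * rest                                  ≡⟨ cong (_* rest) (count≡sum X?) ⟩
    sum (λ x → ⟦ X? x ⟧) * rest                      ≡⟨ *-distribʳ-sum rest (λ x → ⟦ X? x ⟧) ⟩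
    sum (λ x → ⟦ X? x ⟧ * rest)                      ≤⟨ sum-mono pointwise ⟩
    sum (λ x → # (P? ∘ (x ∷_)))                      ∎
    where
    open ≤-Reasoning
    rest = count X? ^ a * count Y? ^ b
    pointwise : ∀ x → ⟦ X? x ⟧ * rest ≤ # (P? ∘ (x ∷_))
    pointwise x with X? x
    ... | no  _ = z≤n
    ... | yes p = ≤-trans (≤-reflexive (+-identityʳ rest)) (#-product a (P? ∘ (x ∷_)) X? Y? λ
      f g xs ys → holds (x ∷ f) g (λ { zero → p ; (suc i) → xs i }) ys)

  -- `finToFun` reads off the digits of a number in the order in which `∑` builds a vector, but the
  -- two functions agree only pointwise; `resp` takes the place of extensionality.
  count-finToFun : ∀ n {P : Pred (Fin n → Fin k) 0ℓ} (P? : Decidable P) →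
                   (∀ {f g} → (∀ i → f i ≡ g i) → P f → P g) →
                   count {k ^ n} (P? ∘ finToFun) ≡ # (P? ∘ lookup)
  count-finToFun n P? resp = trans (count≡sum (P? ∘ finToFun)) (sum-finToFun n P? resp)
    where
    ⟦⟧-resp : ∀ {n} {P : Pred (Fin n → Fin k) 0ℓ} (P? : Decidable P) →
              (∀ {f g} → (∀ i → f i ≡ g i) → P f → P g) →
              ∀ {f g} → (∀ i → f i ≡ g i) → ⟦ P? f ⟧ ≡ ⟦ P? g ⟧
    ⟦⟧-resp P? resp {f} {g} f≗g =
      ≤-antisym (⟦⟧-mono (P? f) (P? g) (resp f≗g)) (⟦⟧-mono (P? g) (P? f) (resp (sym ∘ f≗g)))

    cons : ∀ {n} → Fin k → (Fin n → Fin k) → Fin (suc n) → Fin k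
    cons x f zero    = x
    cons x f (suc i) = f i

    sum-finToFun : ∀ n {P : Pred (Fin n → Fin k) 0ℓ} (P? : Decidable P) →
                   (∀ {f g} → (∀ i → f i ≡ g i) → P f → P g) →
                   sum {k ^ n} (λ i → ⟦ P? (finToFun i) ⟧) ≡ # (P? ∘ lookup)
    sum-finToFun zero P? resp = trans (+-identityʳ _) (⟦⟧-resp P? resp (λ ()))
    sum-finToFun (suc n) P? resp = trans (sum-combine k {k ^ n} (λ i → ⟦ P? (finToFun i) ⟧)) (sum-cong-≗ λ x → begin
      sum {k ^ n} (λ j → ⟦ P? (finToFun (combine x j)) ⟧)
        ≡⟨ sum-cong-≗ {k ^ n} (λ j → ⟦⟧-resp P? resp (split x j)) ⟩
      sum {k ^ n} (λ j → ⟦ P? (cons x (finToFun j)) ⟧)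
        ≡⟨ sum-finToFun n (P? ∘ cons x) (λ f≗g → resp (λ { zero → refl ; (suc i) → f≗g i })) ⟩
      ∑ (λ f → ⟦ P? (cons x (lookup f)) ⟧)
        ≡⟨ ∑-cong (λ f → ⟦⟧-resp P? resp {cons x (lookup f)} {lookup (x ∷ f)} (λ { zero → refl ; (suc i) → refl })) ⟩
      ∑ (λ f → ⟦ P? (lookup (x ∷ f)) ⟧) ∎)
      where
      open ≡-Reasoning
      split : ∀ x (j : Fin (k ^ n)) i → finToFun {k} {suc n} (combine x j) i ≡ cons x (finToFun j) i
      split x j zero    = cong proj₁ (remQuot-combine x j)
      split x j (suc i) = cong (λ q → finToFun {k} {n} (proj₂ q) i) (remQuot-combine x j)

-- Numerical estimates

-- Bernoulli's inequality 1 + e/s ≤ (1 + 1/s)^e, multiplied by s^(e+1) to stay in ℕ.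
bernoulli : ∀ s e → s ^ e * (s + e) ≤ s * suc s ^ e
bernoulli s zero = ≤-reflexive (rearrange s)
  where
  rearrange : ∀ s → 1 * (s + 0) ≡ s * 1
  rearrange = solve-∀
bernoulli s (suc e) = begin
  s * s ^ e * (s + suc e)                    ≡⟨ split s (s ^ e) e ⟩
  s * (s ^ e * (s + e)) + s * s ^ e          ≤⟨ +-mono-≤ (*-monoʳ-≤ s (bernoulli s e)) (*-monoʳ-≤ s (^-monoˡ-≤ e (n≤1+n s))) ⟩
  s * (s * suc s ^ e) + s * suc s ^ e        ≡⟨ merge s (suc s ^ e) ⟩
  s * (suc s * suc s ^ e)                    ∎
  where
  open ≤-Reasoning
  split : ∀ s p e → s * p * (s + suc e) ≡ s * (p * (s + e)) + s * p
  split = solve-∀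
  merge : ∀ s q → s * (s * q) + s * q ≡ s * (suc s * q)
  merge = solve-∀

-- Bernoulli's inequality at e = sc gives (1 + 1/s)^e ≥ 1 + c. It is applied to the degree sum of
-- `H`, whose successor is at most Δ², and to Δ - 1.
exponential-gap : ∀ s → 1 ≤ s → ∀ c → ∃[ e ] s ^ e * c < suc s ^ e
exponential-gap s@(suc _) _ c = s * c , *-cancelˡ-< s _ _ (begin-strict
  s * (s ^ e * c)        <⟨ m<m+n _ (m^n>0 s e) ⟩
  s * (s ^ e * c) + s ^ e ≤⟨ +-monoʳ-≤ _ (m≤n*m (s ^ e) s) ⟩
  s * (s ^ e * c) + s * s ^ e ≡⟨ collect s (s ^ e) c ⟩
  s ^ e * (s + s * c)    ≤⟨ bernoulli s e ⟩
  s * suc s ^ e          ∎)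
  where
  open ≤-Reasoning
  e = s * c
  collect : ∀ s p c → s * (p * c) + s * p ≡ p * (s + s * c)
  collect = solve-∀

^-*-distrib : ∀ a b n → (a * b) ^ n ≡ a ^ n * b ^ n
^-*-distrib a b zero    = refl
^-*-distrib a b (suc n) = trans (cong (a * b *_) (^-*-distrib a b n)) (swap a b (a ^ n) (b ^ n))
  where
  swap : ∀ a b x y → a * b * (x * y) ≡ a * x * (b * y)
  swap = solve-∀

n≤m^n : ∀ {m} → 2 ≤ m → ∀ n → n ≤ m ^ n
n≤m^n {m} 2≤m zero    = z≤n
n≤m^n {m} 2≤m (suc n) = begin
  1 + n              ≤⟨ +-mono-≤ (m^n>0 m {{>-nonZero (≤-trans (s≤s z≤n) 2≤m)}} n) (n≤m^n 2≤m n) ⟩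
  m ^ n + m ^ n      ≡⟨ cong (m ^ n +_) (+-identityʳ _) ⟨
  2 * m ^ n          ≤⟨ *-monoˡ-≤ (m ^ n) 2≤m ⟩
  m * m ^ n          ∎
  where open ≤-Reasoning

-- As s + 1 ≤ Δ², the gap shows s^e < Δ^(2e-1): every `e` disjoint edges save more than a factor Δ.
-- Hence eδ disjoint edges save more than Δ^δ.
matching-gap : ∀ {s Δ e δ n r} → 1 ≤ Δ → s < Δ * Δ → s ^ e * Δ < suc s ^ e → 1 ≤ δ → δ ≤ n →
               (e * δ + e * δ) + r ≡ n → s ^ (e * δ) * Δ ^ r < Δ ^ (n ∸ δ)
matching-gap {s} {Δ} {e} {δ} {n} {r} 1≤Δ s<Δ² gap 1≤δ δ≤n size = *-cancelʳ-< (Δ ^ δ) _ _ (begin-strict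
  s ^ (e * δ) * Δ ^ r * Δ ^ δ          ≡⟨ cong (λ z → z * Δ ^ r * Δ ^ δ) (^-*-assoc s e δ) ⟨
  (s ^ e) ^ δ * Δ ^ r * Δ ^ δ          ≡⟨ swap ((s ^ e) ^ δ) (Δ ^ r) (Δ ^ δ) ⟩
  (s ^ e) ^ δ * Δ ^ δ * Δ ^ r          ≡⟨ cong (_* Δ ^ r) (^-*-distrib (s ^ e) Δ δ) ⟨
  (s ^ e * Δ) ^ δ * Δ ^ r              <⟨ *-monoˡ-< (Δ ^ r) {{m^n≢0 Δ r}} (^-monoˡ-< δ gap) ⟩
  (suc s ^ e) ^ δ * Δ ^ r              ≤⟨ *-monoˡ-≤ (Δ ^ r) (^-monoˡ-≤ δ (^-monoˡ-≤ e s<Δ²)) ⟩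
  ((Δ * Δ) ^ e) ^ δ * Δ ^ r            ≡⟨ cong (_* Δ ^ r) (^-*-assoc (Δ * Δ) e δ) ⟩
  (Δ * Δ) ^ (e * δ) * Δ ^ r            ≡⟨ cong (_* Δ ^ r) (^-*-distrib Δ Δ (e * δ)) ⟩
  Δ ^ (e * δ) * Δ ^ (e * δ) * Δ ^ r    ≡⟨ cong (_* Δ ^ r) (^-distribˡ-+-* Δ (e * δ) (e * δ)) ⟨
  Δ ^ (e * δ + e * δ) * Δ ^ r          ≡⟨ ^-distribˡ-+-* Δ (e * δ + e * δ) r ⟨
  Δ ^ (e * δ + e * δ + r)              ≡⟨ cong (Δ ^_) (trans size (sym (m∸n+n≡m δ≤n))) ⟩
  Δ ^ (n ∸ δ + δ)                      ≡⟨ ^-distribˡ-+-* Δ (n ∸ δ) δ ⟩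
  Δ ^ (n ∸ δ) * Δ ^ δ                  ∎)
  where
  open ≤-Reasoning
  instance
    _ : NonZero Δ
    _ = >-nonZero 1≤Δ
    _ : NonZero δ
    _ = >-nonZero 1≤δ
  swap : ∀ a b c → a * b * c ≡ a * c * b
  swap = solve-∀

-- On the left a vertex of `L` is chosen in δ ways and given one of `k` colours, its tδ neighbours
-- have `p` colours each, and the other vertices Δ each. The gap saves a factor kΔ³ per unit of δ,
-- which absorbs everything else.
avoiding-gap : ∀ {Δ p k t δ r r′} → Δ ≡ suc p → 2 ≤ Δ → 1 ≤ k → 1 ≤ δ →
               p ^ t * (k * (Δ * (Δ * Δ))) < suc p ^ t → (t * δ + 1) + r′ ≡ (2 + δ) + r →
               δ * (p ^ (t * δ) * k * Δ ^ r′) < Δ ^ r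
avoiding-gap {Δ} {p} {k} {t} {δ} {r} {r′} refl 2≤Δ 1≤k 1≤δ gap size = *-cancelʳ-< (Δ ^ (2 + δ)) _ _ (begin-strict
  -- The three factors Δ^δ come from δ ≤ Δ^δ, from Δ^(2+δ), and from one spare Δ ≤ Δ^δ. The other
  -- spare Δ pays for the vertex counted by the 1 in `size`.
  δ * (p ^ (t * δ) * k * Δ ^ r′) * Δ ^ (2 + δ)             ≤⟨ *-monoˡ-≤ (Δ ^ (2 + δ)) (*-monoˡ-≤ _ (n≤m^n 2≤Δ δ)) ⟩
  Δ ^ δ * (p ^ (t * δ) * k * Δ ^ r′) * Δ ^ (2 + δ)         ≤⟨ *-monoˡ-≤ (Δ ^ (2 + δ)) (*-monoʳ-≤ (Δ ^ δ) (*-monoˡ-≤ (Δ ^ r′) (*-monoʳ-≤ (p ^ (t * δ)) (x≤x^δ k)))) ⟩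
  Δ ^ δ * (p ^ (t * δ) * k ^ δ * Δ ^ r′) * Δ ^ (2 + δ)     ≡⟨ rearrange (Δ ^ δ) (p ^ (t * δ)) (k ^ δ) (Δ ^ r′) Δ ⟩
  p ^ (t * δ) * (k ^ δ * (Δ * (Δ ^ δ * Δ ^ δ))) * (Δ * Δ ^ r′)
    ≤⟨ *-monoˡ-≤ (Δ * Δ ^ r′) (*-monoʳ-≤ (p ^ (t * δ)) (*-monoʳ-≤ (k ^ δ) (*-monoˡ-≤ (Δ ^ δ * Δ ^ δ) (x≤x^δ Δ)))) ⟩
  p ^ (t * δ) * (k ^ δ * (Δ ^ δ * (Δ ^ δ * Δ ^ δ))) * (Δ * Δ ^ r′)
    ≡⟨ cong (_* (Δ * Δ ^ r′)) powers ⟩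
  (p ^ t * (k * (Δ * (Δ * Δ)))) ^ δ * (Δ * Δ ^ r′)         <⟨ *-monoˡ-< (Δ * Δ ^ r′) {{m*n≢0 Δ (Δ ^ r′) {{_}} {{m^n≢0 Δ r′}}}} (^-monoˡ-< δ gap) ⟩
  (Δ ^ t) ^ δ * Δ ^ (1 + r′)                               ≡⟨ cong (_* Δ ^ (1 + r′)) (^-*-assoc Δ t δ) ⟩
  Δ ^ (t * δ) * Δ ^ (1 + r′)                               ≡⟨ ^-distribˡ-+-* Δ (t * δ) (1 + r′) ⟨
  Δ ^ (t * δ + (1 + r′))                                   ≡⟨ cong (Δ ^_) (trans (sym (+-assoc (t * δ) 1 r′)) (trans size (+-comm (2 + δ) r))) ⟩
  Δ ^ (r + (2 + δ))                                        ≡⟨ ^-distribˡ-+-* Δ r (2 + δ) ⟩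
  Δ ^ r * Δ ^ (2 + δ)                                      ∎)
  where
  open ≤-Reasoning
  instance
    _ : NonZero δ
    _ = >-nonZero 1≤δ
    _ : NonZero k
    _ = >-nonZero 1≤k
  x≤x^δ : ∀ x .{{_ : NonZero x}} → x ≤ x ^ δ
  x≤x^δ x = ≤-trans (≤-reflexive (sym (^-identityʳ x))) (^-monoʳ-≤ x 1≤δ)
  rearrange : ∀ d p k r D → d * (p * k * r) * (D * (D * d)) ≡ p * (k * (D * (d * d))) * (D * r)
  rearrange = solve-∀
  powers : p ^ (t * δ) * (k ^ δ * (Δ ^ δ * (Δ ^ δ * Δ ^ δ))) ≡ (p ^ t * (k * (Δ * (Δ * Δ)))) ^ δ
  powers = sym (trans (^-*-distrib (p ^ t) _ δ) (cong₂ _*_ (^-*-assoc p t δ)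
    (trans (^-*-distrib k _ δ) (cong (k ^ δ *_) (trans (^-*-distrib Δ (Δ * Δ) δ) (cong (Δ ^ δ *_) (^-*-distrib Δ Δ δ)))))))

-- Since s + 1 ≤ Δ², one copy of l^δ Δ^r is left beside the main term, and it exceeds the error `B`.
combined-gap : ∀ {s l Δ δ n r B} → 1 ≤ l → s < Δ * Δ → (2 + δ) + r ≡ n → B < Δ ^ r →
               (s * l ^ δ) * Δ ^ r + B < l ^ δ * Δ ^ (n ∸ δ)
combined-gap {s} {l} {Δ} {δ} {r = r} {B} 1≤l s<Δ² refl B<Δ^r = begin-strict
  s * l ^ δ * Δ ^ r + B                        <⟨ +-monoʳ-< _ B<Δ^r ⟩
  s * l ^ δ * Δ ^ r + Δ ^ r                    ≤⟨ +-monoʳ-≤ _ (m≤n*m (Δ ^ r) (l ^ δ) {{m^n≢0 l δ {{>-nonZero 1≤l}}}}) ⟩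
  s * l ^ δ * Δ ^ r + l ^ δ * Δ ^ r            ≡⟨ collect s (l ^ δ) (Δ ^ r) ⟩
  suc s * (l ^ δ * Δ ^ r)                      ≤⟨ *-monoˡ-≤ _ s<Δ² ⟩
  Δ * Δ * (l ^ δ * Δ ^ r)                      ≡⟨ expand Δ (l ^ δ) (Δ ^ r) ⟩
  l ^ δ * Δ ^ (2 + r)                          ≡⟨ cong (λ z → l ^ δ * Δ ^ z) (trans (sym (m+n∸m≡n δ (2 + r))) (cong (_∸ δ) (shift δ r))) ⟩
  l ^ δ * Δ ^ (2 + δ + r ∸ δ)                  ∎
  where
  open ≤-Reasoning
  collect : ∀ s x y → s * x * y + x * y ≡ suc s * (x * y)
  collect = solve-∀
  expand : ∀ D x y → D * D * (x * y) ≡ x * (D * (D * y))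
  expand = solve-∀
  shift : ∀ δ r → δ + (2 + r) ≡ 2 + δ + r
  shift = solve-∀

-- Room for a cover of 2eδ vertices together with tδ neighbours of each. The linear term is raised
-- to 2eδ² by δ ≥ 1, and the `suc` in the constant gives strictness.
cover-small : ∀ e t {δ n} → 1 ≤ δ → suc ((e + e) * suc t) * δ ^ 2 ≤ n →
              (e * δ + e * δ) + (e * δ + e * δ) * (t * δ) < n
cover-small e t {δ} {n} 1≤δ cδ²≤n = begin-strict
  e * δ + e * δ + (e * δ + e * δ) * (t * δ)              ≡⟨ cong (_+ (e * δ + e * δ) * (t * δ)) (collect e δ) ⟨
  (e + e) * δ + (e * δ + e * δ) * (t * δ)                ≤⟨ +-monoˡ-≤ _ (m≤m*n ((e + e) * δ) δ {{>-nonZero 1≤δ}}) ⟩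
  (e + e) * δ * δ + (e * δ + e * δ) * (t * δ)            <⟨ m<m+n _ (*-mono-≤ 1≤δ 1≤δ) ⟩
  (e + e) * δ * δ + (e * δ + e * δ) * (t * δ) + δ * δ    ≡⟨ expand e t δ ⟨
  suc ((e + e) * suc t) * δ ^ 2                          ≤⟨ cδ²≤n ⟩
  n                                                      ∎
  where
  open ≤-Reasoning
  expand : ∀ e t δ → suc ((e + e) * suc t) * (δ * (δ * 1)) ≡ (e + e) * δ * δ + (e * δ + e * δ) * (t * δ) + δ * δ
  expand = solve-∀
  collect : ∀ e δ → (e + e) * δ ≡ e * δ + e * δ
  collect = solve-∀

-- Lists of distinct elements

infix 4 _∈ᶠ?_
_∈ᶠ?_ : ∀ {n} (v : Fin n) (xs : List (Fin n)) → Dec (v ∈ xs)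
_∈ᶠ?_ = _∈?_ Fin._≟_

module _ {A : Set} where

  unique-∷ : ∀ {x : A} {xs} → x ∉ xs → Unique xs → Unique (x ∷ xs)
  unique-∷ x∉xs u = All.tabulate (λ {y} y∈xs x≡y → x∉xs (subst (_∈ _) (sym x≡y) y∈xs)) ∷ u

  unique-⊆⇒length≤ : ∀ {xs ys : List A} → Unique xs → (∀ {x} → x ∈ xs → x ∈ ys) → length xs ≤ length ys
  unique-⊆⇒length≤ {[]} _ _ = z≤n
  unique-⊆⇒length≤ {x ∷ xs} (x≢xs ∷ u) xs⊆ys with ∈-∃++ (xs⊆ys (here refl))
  ... | as , bs , refl = begin
    suc (length xs)                ≤⟨ s≤s (unique-⊆⇒length≤ u remains) ⟩
    suc (length (as ++ bs))        ≡⟨ cong suc (length-++ as) ⟩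
    suc (length as + length bs)    ≡⟨ +-suc (length as) (length bs) ⟨
    length as + suc (length bs)    ≡⟨ length-++ as ⟨
    length (as ++ x ∷ bs)          ∎
    where
    open ≤-Reasoning
    remains : ∀ {z} → z ∈ xs → z ∈ as ++ bs
    remains z∈xs with ∈-++⁻ as (xs⊆ys (there z∈xs))
    ... | inj₁ z∈as         = ∈-++⁺ˡ z∈as
    ... | inj₂ (here refl)  = contradiction refl (All.lookup x≢xs z∈xs)
    ... | inj₂ (there z∈bs) = ∈-++⁺ʳ as z∈bs

module _ {n : ℕ} where

  length-allFin : length (allFin n) ≡ n
  length-allFin = length-tabulate id

  unique⇒length≤ : ∀ {xs : List (Fin n)} → Unique xs → length xs ≤ n
  unique⇒length≤ u = ≤-trans (unique-⊆⇒length≤ u (λ _ → ∈-allFin _)) (≤-reflexive length-allFin)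

  length<⇒∃∉ : ∀ (xs : List (Fin n)) → length xs < n → ∃[ v ] v ∉ xs
  length<⇒∃∉ xs short with any? (λ v → ¬? (v ∈ᶠ? xs))
  ... | yes missing = missing
  ... | no  ¬missing = contradiction
    (unique-⊆⇒length≤ (Unique.allFin⁺ n) λ {v} _ → decidable-stable (v ∈ᶠ? xs) λ v∉xs → ¬missing (v , v∉xs))
    (<⇒≱ (≤-trans short (≤-reflexive (sym length-allFin))))

module _ {m n : ℕ} {P : Pred (Fin m) 0ℓ} {Q : Pred (Fin n) 0ℓ} (P? : Decidable P) (Q? : Decidable Q)
         (φ : Fin m → Fin n) (φ-injective : Injective _≡_ _≡_ φ) (φ-resp : ∀ i → P i → Q (φ i)) where

  private
    image : List (Fin n)
    image = map φ (filter P? (allFin m))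

    image-unique : Unique image
    image-unique = Unique.map⁺ φ-injective (Unique.filter⁺ P? (Unique.allFin⁺ m))

    length-image : length image ≡ count P?
    length-image = length-map φ (filter P? (allFin m))

    image⊆Q : ∀ {j} → j ∈ image → j ∈ filter Q? (allFin n)
    image⊆Q j∈ with ∈-map⁻ φ j∈
    ... | i , i∈ , refl = ∈-filter⁺ Q? (∈-allFin _) (φ-resp i (proj₂ (∈-filter⁻ P? {xs = allFin m} i∈)))

  count-injective-≤ : count P? ≤ count Q?
  count-injective-≤ = ≤-trans (≤-reflexive (sym length-image)) (unique-⊆⇒length≤ image-unique image⊆Q)

  count-injective-< : ∀ j → Q j → (∀ i → P i → φ i ≢ j) → count P? < count Q?
  count-injective-< j q missed =
    ≤-trans (≤-reflexive (cong suc (sym length-image))) (unique-⊆⇒length≤ (unique-∷ j∉image image-unique) λ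
      { (here refl) → ∈-filter⁺ Q? (∈-allFin _) q ; (there j∈) → image⊆Q j∈ })
    where
    j∉image : j ∉ image
    j∉image j∈ with ∈-map⁻ φ j∈
    ... | i , i∈ , eq = missed i (proj₂ (∈-filter⁻ P? {xs = allFin m} i∈)) (sym eq)

-- Colourings of part of a graph

⟦⟧≤1 : ∀ {A : Set} (A? : Dec A) → ⟦ A? ⟧ ≤ 1
⟦⟧≤1 (yes _) = ≤-refl
⟦⟧≤1 (no _)  = z≤n

sum-⟦⟧≤ : ∀ {n} {P : Pred (Fin n) 0ℓ} (P? : Decidable P) → sum (λ x → ⟦ P? x ⟧) ≤ n
sum-⟦⟧≤ {n} P? = begin
  sum (λ x → ⟦ P? x ⟧)    ≡⟨ count≡sum P? ⟨
  count P?                ≤⟨ length-filter P? (allFin n) ⟩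
  length (allFin n)       ≡⟨ length-allFin ⟩
  n                       ∎
  where open ≤-Reasoning

-- In the uses below `Q` says that the part coloured earlier is valid, and `sum f` counts its
-- extensions; an invalid part has none.
sum-≤-supported : ∀ {n d} {Q : Set} (Q? : Dec Q) (f : Fin n → ℕ) →
                  (¬ Q → ∀ x → f x ≡ 0) → (Q → sum f ≤ d) → sum f ≤ d * ⟦ Q? ⟧
sum-≤-supported (yes q) f _ bounded = ≤-trans (bounded q) (≤-reflexive (sym (*-identityʳ _)))
sum-≤-supported {n} (no ¬q) f vanishes _ =
  ≤-trans (≤-reflexive (trans (sum-cong-≗ (vanishes ¬q)) (trans (sum-const n) (*-zeroʳ n)))) z≤n

-- The number of ordered pairs of adjacent vertices, a loop giving one pair: these are the
-- colourings of a single edge.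
degreeSum : ∀ {k} → Graph k → ℕ
degreeSum H = sum (degree H)

-- `C v` is the set of colours permitted at `v`. The instances are no restriction, only colours of
-- maximum degree on a given set, and no colour of maximum degree at a given vertex.
module PartialHom {n k : ℕ} (G : SimpleGraph n) (H : Graph k) {C : Fin n → Pred (Fin k) 0ℓ}
                  (C? : ∀ v → Decidable (C v)) where
  private
    module G = SimpleGraph G
    module H = Graph H

  record IsHomOn (S : List (Fin n)) (f : Vec (Fin k) n) : Set where
    field
      colour : ∀ {v} → v ∈ S → C v (lookup f v)
      edge   : ∀ {v w} → v ∈ S → w ∈ S → v G.~ w → lookup f v H.~ lookup f w
  open IsHomOn

  ColouredHom : Pred (Vec (Fin k) n) 0ℓ
  ColouredHom f = (∀ v → C v (lookup f v)) × IsHom G H (lookup f)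

  abstract
    isHomOn? : ∀ S → Decidable (IsHomOn S)
    isHomOn? S f = map′
      (λ all → record { colour = λ v∈S → proj₁ (All.lookup all v∈S)
                      ; edge   = λ v∈S w∈S → All.lookup (proj₂ (All.lookup all v∈S)) w∈S })
      (λ hom → All.tabulate λ v∈S → colour hom v∈S , All.tabulate λ w∈S → edge hom v∈S w∈S)
      (All.all? (λ v → C? v (lookup f v) ×-dec
                       All.all? (λ w → (v G.~? w) →-dec (lookup f v H.~? lookup f w)) S) S)

    colouredHom? : Decidable ColouredHom
    colouredHom? f = all? (λ v → C? v (lookup f v)) ×-dec isHom? G H (lookup f)

  -- The colourings counted are unconstrained outside S; the powers of k normalise this away, so that a vertex
  -- is added to S by averaging over a recolouring of it.
  record Bound (S : List (Fin n)) (N : ℕ) : Set where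
    constructor mkBound
    field
      scaled-≤ : # (isHomOn? S) * k ^ length S ≤ N * k ^ n
  open Bound

  module _ {v S x} {f : Vec (Fin k) n} (v∉S : v ∉ S) (hom : IsHomOn (v ∷ S) (f [ v ]≔ x)) where
    private
      unchanged : ∀ {w} → w ∈ S → lookup (f [ v ]≔ x) w ≡ lookup f w
      unchanged w∈S = lookup∘update′ (λ w≡v → v∉S (subst (_∈ S) w≡v w∈S)) f x

    restrict : IsHomOn S f
    restrict = record
      { colour = λ {u} u∈S → subst (C u) (unchanged u∈S) (colour hom (there u∈S))
      ; edge   = λ u∈S w∈S u~w → subst₂ H._~_ (unchanged u∈S) (unchanged w∈S) (edge hom (there u∈S) (there w∈S) u~w)
      }

    new-colour : C v x
    new-colour = subst (C v) (lookup∘update v f x) (colour hom (here refl))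

    new-edge : ∀ {w} → w ∈ S → v G.~ w → x H.~ lookup f w
    new-edge w∈S v~w = subst₂ H._~_ (lookup∘update v f x) (unchanged w∈S) (edge hom (here refl) (there w∈S) v~w)

  bound-[] : Bound [] 1
  bound-[] = mkBound (begin
    # (isHomOn? []) * 1   ≡⟨ *-identityʳ _ ⟩
    # (isHomOn? [])       ≤⟨ ∑-mono (λ f → ⟦⟧≤1 (isHomOn? [] f)) ⟩
    ∑ {k} {n} (λ _ → 1)   ≡⟨ ∑-const n ⟩
    k ^ n * 1             ≡⟨ *-comm (k ^ n) 1 ⟩
    1 * k ^ n             ∎)
    where open ≤-Reasoning

  -- Recolouring `v` leaves `S` untouched, so the result is valid on `v ∷ S` only if `f` was valid
  -- on `S`, and then for at most `d` colours of `v`.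
  bound-∷ : ∀ {v S d N} → v ∉ S →
            (∀ f → IsHomOn S f → sum (λ x → ⟦ isHomOn? (v ∷ S) (f [ v ]≔ x) ⟧) ≤ d) →
            Bound S N → Bound (v ∷ S) (d * N)
  bound-∷ {v} {S} {d} {N} v∉S choices bound = mkBound (begin
    # (isHomOn? (v ∷ S)) * (k * k ^ length S)      ≡⟨ swap (# (isHomOn? (v ∷ S))) k (k ^ length S) ⟩
    k * # (isHomOn? (v ∷ S)) * k ^ length S        ≡⟨ cong (_* k ^ length S) (∑-resample v (λ f → ⟦ isHomOn? (v ∷ S) f ⟧)) ⟩
    ∑ (λ f → sum (F f)) * k ^ length S             ≤⟨ *-monoˡ-≤ (k ^ length S) (∑-mono λ f → sum-≤-supported (isHomOn? S f) (F f)
                                                        (λ ¬hom x → ⟦⟧-fails (isHomOn? (v ∷ S) _) (¬hom ∘ restrict v∉S)) (choices f)) ⟩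
    ∑ (λ f → d * ⟦ isHomOn? S f ⟧) * k ^ length S  ≡⟨ cong (_* k ^ length S) (∑-*ˡ d (λ f → ⟦ isHomOn? S f ⟧)) ⟨
    d * # (isHomOn? S) * k ^ length S              ≡⟨ *-assoc d _ _ ⟩
    d * (# (isHomOn? S) * k ^ length S)            ≤⟨ *-monoʳ-≤ d (scaled-≤ bound) ⟩
    d * (N * k ^ n)                                ≡⟨ *-assoc d N _ ⟨
    d * N * k ^ n                                  ∎)
    where
    open ≤-Reasoning
    F = λ f x → ⟦ isHomOn? (v ∷ S) (f [ v ]≔ x) ⟧
    swap : ∀ a b c → a * (b * c) ≡ b * a * c
    swap = solve-∀

  bound-colour : ∀ {v S N} → v ∉ S → Bound S N → Bound (v ∷ S) (count (C? v) * N)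
  bound-colour {v} {S} v∉S = bound-∷ v∉S λ f _ → begin
    sum (λ x → ⟦ isHomOn? (v ∷ S) (f [ v ]≔ x) ⟧)  ≤⟨ sum-mono (λ x → ⟦⟧-mono (isHomOn? (v ∷ S) _) (C? v x) (new-colour v∉S)) ⟩
    sum (λ x → ⟦ C? v x ⟧)                         ≡⟨ count≡sum (C? v) ⟨
    count (C? v)                                   ∎
    where open ≤-Reasoning

  -- The colour of `v` must be a neighbour in `H` of the colour already given to `w`.
  bound-neighbour : ∀ {v w S d N} → v ∉ S → w ∈ S → v G.~ w → (∀ x → C w x → degree H x ≤ d) →
                    Bound S N → Bound (v ∷ S) (d * N)
  bound-neighbour {v} {w} {S} {d} v∉S w∈S v~w degree≤d = bound-∷ v∉S λ f hom → begin
    sum (λ x → ⟦ isHomOn? (v ∷ S) (f [ v ]≔ x) ⟧)  ≤⟨ sum-mono (λ x → ⟦⟧-mono (isHomOn? (v ∷ S) _) (lookup f w H.~? x) (λ hom′ → H.~-sym (new-edge v∉S hom′ w∈S v~w))) ⟩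
    sum (λ x → ⟦ lookup f w H.~? x ⟧)              ≡⟨ count≡sum (lookup f w H.~?_) ⟨
    degree H (lookup f w)                          ≤⟨ degree≤d (lookup f w) (colour hom w∈S) ⟩
    d                                              ∎
    where open ≤-Reasoning

  -- Once `v` has colour `y`, the colour of `u` is a neighbour of `y`; summing over `y` gives the
  -- degree sum.
  bound-edge : ∀ {u v S N} → u ∉ v ∷ S → v ∉ S → u G.~ v →
               Bound S N → Bound (u ∷ v ∷ S) (degreeSum H * N)
  bound-edge {u} {v} {S} {N} u∉ v∉S u~v bound = mkBound (begin
    # P? * (k * (k * k ^ length S))                     ≡⟨ swap (# P?) k (k ^ length S) ⟩
    k * (k * # P?) * k ^ length S                       ≡⟨ cong (λ z → k * z * k ^ length S) (∑-resample u (λ f → ⟦ P? f ⟧)) ⟩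
    k * ∑ (λ f → sum (λ x → ⟦ P? (f [ u ]≔ x) ⟧)) * k ^ length S
      ≡⟨ cong (_* k ^ length S) (∑-resample v (λ f → sum (λ x → ⟦ P? (f [ u ]≔ x) ⟧))) ⟩
    ∑ (λ f → sum (λ y → F f y)) * k ^ length S
      ≤⟨ *-monoˡ-≤ (k ^ length S) (∑-mono λ f → sum-≤-supported (isHomOn? S f) (F f) (vanishes f) (λ _ → sum-mono (bounded f))) ⟩
    ∑ (λ f → degreeSum H * ⟦ isHomOn? S f ⟧) * k ^ length S
      ≡⟨ cong (_* k ^ length S) (∑-*ˡ (degreeSum H) (λ f → ⟦ isHomOn? S f ⟧)) ⟨
    degreeSum H * # (isHomOn? S) * k ^ length S         ≡⟨ *-assoc (degreeSum H) _ _ ⟩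
    degreeSum H * (# (isHomOn? S) * k ^ length S)       ≤⟨ *-monoʳ-≤ (degreeSum H) (scaled-≤ bound) ⟩
    degreeSum H * (N * k ^ n)                           ≡⟨ *-assoc (degreeSum H) N _ ⟨
    degreeSum H * N * k ^ n                             ∎)
    where
    open ≤-Reasoning
    P? = isHomOn? (u ∷ v ∷ S)
    F = λ f y → sum (λ x → ⟦ P? ((f [ v ]≔ y) [ u ]≔ x) ⟧)
    vanishes : ∀ f → ¬ IsHomOn S f → ∀ y → F f y ≡ 0
    vanishes f ¬hom y = trans
      (sum-cong-≗ λ x → ⟦⟧-fails (P? ((f [ v ]≔ y) [ u ]≔ x)) (¬hom ∘ restrict v∉S ∘ restrict u∉))
      (trans (sum-const k) (*-zeroʳ k))
    bounded : ∀ f y → F f y ≤ degree H y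
    bounded f y = ≤-trans
      (sum-mono λ x → ⟦⟧-mono (P? _) (y H.~? x) λ hom →
        H.~-sym (subst (x H.~_) (lookup∘update v f y) (new-edge u∉ hom (here refl) u~v)))
      (≤-reflexive (sym (count≡sum (y H.~?_))))
    swap : ∀ a b c → a * (b * (b * c)) ≡ b * (b * a) * c
    swap = solve-∀

  module _ .{{_ : NonZero k}} {Δ : ℕ} (degree≤Δ : ∀ x → degree H x ≤ Δ) (degreeSum≤Δ² : degreeSum H ≤ Δ * Δ)
           (neighbour : ∀ v → ∃[ w ] v G.~ w) where

    -- Each remaining vertex costs a factor Δ. One with a coloured neighbour has at most Δ colours;
    -- if there is none, an uncoloured vertex and a neighbour of it form an edge with at most Δ²
    -- colourings.
    bound-total : ∀ r {S N} → Unique S → length S + r ≡ n → Bound S N → # colouredHom? ≤ N * Δ ^ r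
    bound-total zero {S} {N} uniq size bound = begin
      # colouredHom?     ≤⟨ #-mono colouredHom? (isHomOn? S) (λ f (c , hom) → record { colour = λ {v} _ → c v ; edge = λ {v} {w} _ _ → hom v w }) ⟩
      -- All `n` vertices are in `S`, so both sides carry the positive factor `k ^ n`.
      # (isHomOn? S)     ≤⟨ *-cancelʳ-≤ _ N (k ^ n) {{m^n≢0 k n}} (subst (λ z → # (isHomOn? S) * k ^ z ≤ N * k ^ n) (trans (sym (+-identityʳ _)) size) (scaled-≤ bound)) ⟩
      N                  ≡⟨ *-identityʳ N ⟨
      N * 1              ∎
      where open ≤-Reasoning
    bound-total (suc r) {S} {N} uniq size bound
      with any? (λ v → ¬? (v ∈ᶠ? S) ×-dec any? (λ w → (w ∈ᶠ? S) ×-dec (v G.~? w)))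
    ... | yes (v , v∉S , w , w∈S , v~w) =
      ≤-trans (bound-total r (unique-∷ v∉S uniq) (trans (sym (+-suc (length S) r)) size)
                (bound-neighbour v∉S w∈S v~w (λ x _ → degree≤Δ x) bound))
              (≤-reflexive (swap Δ N (Δ ^ r)))
      where
      swap : ∀ a b c → a * b * c ≡ b * (a * c)
      swap = solve-∀
    ... | no ¬attached = isolated-edge r size
      where
      missing = length<⇒∃∉ S (≤-trans (m<m+n (length S) (s≤s z≤n)) (≤-reflexive size))
      v = proj₁ missing
      v∉S = proj₂ missing
      w = proj₁ (neighbour v)
      v~w = proj₂ (neighbour v)
      w∉ : w ∉ v ∷ S
      w∉ (here w≡v)  = G.loopless (sym w≡v) v~w
      w∉ (there w∈S) = ¬attached (v , v∉S , w , w∈S , v~w)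
      uniq′ : Unique (w ∷ v ∷ S)
      uniq′ = unique-∷ w∉ (unique-∷ v∉S uniq)
      isolated-edge : ∀ r → length S + suc r ≡ n → # colouredHom? ≤ N * Δ ^ suc r
      -- A single vertex cannot be left over, as `v` and `w` are distinct and both uncoloured.
      isolated-edge zero size = contradiction (unique⇒length≤ uniq′)
        (<⇒≱ (s≤s (≤-reflexive (trans (sym size) (+-comm (length S) 1)))))
      isolated-edge (suc r) size = begin
        # colouredHom?              ≤⟨ bound-total r uniq′ (trans (shift (length S) r) size) (bound-edge w∉ v∉S (G.~-sym v~w) bound) ⟩
        degreeSum H * N * Δ ^ r     ≤⟨ *-monoˡ-≤ (Δ ^ r) (*-monoˡ-≤ N degreeSum≤Δ²) ⟩
        Δ * Δ * N * Δ ^ r           ≡⟨ swap Δ N (Δ ^ r) ⟩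
        N * Δ ^ suc (suc r)         ∎
        where
        open ≤-Reasoning
        shift : ∀ l r → suc (suc l) + r ≡ l + suc (suc r)
        shift = solve-∀
        swap : ∀ a b c → a * a * b * c ≡ b * (a * (a * c))
        swap = solve-∀

  bound-colours : ∀ {l L} → Unique L → (∀ {v} → v ∈ L → count (C? v) ≡ l) → Bound L (l ^ length L)
  bound-colours {L = []}    _            _     = bound-[]
  bound-colours {l} {v ∷ L} (v≢L ∷ uniq) sizes = subst (λ c → Bound (v ∷ L) (c * l ^ length L)) (sizes (here refl))
    (bound-colour (λ v∈L → All.lookup v≢L v∈L refl) (bound-colours uniq (sizes ∘ there)))

  -- Vertices enter at the front of the list, so `a` at its end is coloured first, in at most `k`
  -- ways; then each vertex of `M` has at most `d` colours.
  bound-star : ∀ {a d M} → (∀ x → C a x → degree H x ≤ d) → Unique M → All (G._~ a) M →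
               Bound (M ++ a ∷ []) (d ^ length M * k)
  bound-star {a} {M = []} _ _ _ = subst (Bound (a ∷ [])) (*-comm k 1) (bound-∷ {S = []} (λ ()) (λ f _ → sum-⟦⟧≤ (λ x → isHomOn? (a ∷ []) (f [ a ]≔ x))) bound-[])
  bound-star {a} {d} {v ∷ M} degree≤d (v≢M ∷ uniq) (v~a ∷ M~a) =
    subst (Bound (v ∷ M ++ a ∷ [])) (sym (*-assoc d (d ^ length M) k))
      (bound-neighbour v∉ (∈-++⁺ʳ M (here refl)) v~a degree≤d (bound-star degree≤d uniq M~a))
    where
    v∉ : v ∉ M ++ a ∷ []
    v∉ v∈ with ∈-++⁻ M v∈
    ... | inj₁ v∈M        = All.lookup v≢M v∈M refl
    ... | inj₂ (here v≡a) = G.loopless v≡a v~a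

  -- `S` collects the ends of disjoint edges chosen greedily. When no edge avoids `S`, it is a
  -- vertex cover.
  matching-or-cover : ∀ m →
    (∃[ S ] (Unique S × length S ≡ m + m × Bound S (degreeSum H ^ m)))
    ⊎ (∃[ S ] (length S ≤ m + m × (∀ {v w} → v G.~ w → v ∈ S ⊎ w ∈ S)))
  matching-or-cover zero = inj₁ ([] , [] , refl , bound-[])
  matching-or-cover (suc m) with matching-or-cover m
  ... | inj₂ (S , short , cover) = inj₂ (S , ≤-trans short (+-mono-≤ (n≤1+n m) (n≤1+n m)) , cover)
  ... | inj₁ (S , uniq , size , bound)
    with any? (λ v → any? (λ w → ¬? (v ∈ᶠ? S) ×-dec ¬? (w ∈ᶠ? S) ×-dec (v G.~? w)))
  ...   | yes (v , w , v∉S , w∉S , v~w) =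
    inj₁ (v ∷ w ∷ S , unique-∷ v∉ (unique-∷ w∉S uniq) , cong suc (trans (cong suc size) (sym (+-suc m m))) , bound-edge v∉ w∉S v~w bound)
    where
    v∉ : v ∉ w ∷ S
    v∉ (here v≡w)  = G.loopless v≡w v~w
    v∉ (there v∈S) = v∉S v∈S
  ...   | no ¬edge = inj₂ (S , ≤-trans (≤-reflexive size) (+-mono-≤ (n≤1+n m) (n≤1+n m)) , λ {v} {w} v~w → cover v w v~w (v ∈ᶠ? S) (w ∈ᶠ? S))
    where
    cover : ∀ v w → v G.~ w → Dec (v ∈ S) → Dec (w ∈ S) → v ∈ S ⊎ w ∈ S
    cover v w v~w (yes v∈S) _         = inj₁ v∈S
    cover v w v~w (no _)    (yes w∈S) = inj₂ w∈S
    cover v w v~w (no v∉S)  (no w∉S)  = contradiction (v , w , v∉S , w∉S , v~w) ¬edge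

-- Sparse target graphs and subgraph monotonicity

sum-mono-< : ∀ {n} {f g : Fin n → ℕ} → (∀ i → f i ≤ g i) → ∀ i → f i < g i → sum f < sum g
sum-mono-< f≤g zero    fi<gi = +-mono-<-≤ fi<gi (sum-mono (f≤g ∘ suc))
sum-mono-< f≤g (suc i) fi<gi = +-mono-≤-< (f≤g zero) (sum-mono-< (f≤g ∘ suc) i fi<gi)

count-mono : ∀ {n} {P Q : Pred (Fin n) 0ℓ} (P? : Decidable P) (Q? : Decidable Q) →
             (∀ i → P i → Q i) → count P? ≤ count Q?
count-mono P? Q? = count-injective-≤ P? Q? id id

module _ {n k : ℕ} (G : SimpleGraph n) (H : Graph k) where
  private
    module G = SimpleGraph G
    module H = Graph H

  isHom-resp-≗ : ∀ {f g : Fin n → Fin k} → f ≗ g → IsHom G H f → IsHom G H g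
  isHom-resp-≗ f≗g hom v w v~w = subst₂ H._~_ (f≗g v) (f≗g w) (hom v w v~w)

  hom≡# : hom G H ≡ # (λ f → isHom? G H (lookup f))
  hom≡# = count-finToFun n (isHom? G H) isHom-resp-≗

module _ {k : ℕ} (H : Graph k) where
  open Graph H

  degree≤k : ∀ v → degree H v ≤ k
  degree≤k v = ≤-trans (length-filter (v ~?_) (allFin k)) (≤-reflexive length-allFin)

  degree≡k⇒dominating : ∀ {v} → degree H v ≡ k → LoopedDominating H v
  degree≡k⇒dominating {v} full w = decidable-stable (v ~? w) λ v≁w →
    <⇒≢ (≤-trans (filter-notAll (v ~?_) (allFin k) (Any.map (λ { refl → v≁w }) (∈-allFin w))) (≤-reflexive length-allFin)) full

  dominating⇒degree≡k : ∀ {v} → LoopedDominating H v → degree H v ≡ k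
  dominating⇒degree≡k {v} dom = trans (cong length (filter-all (v ~?_) {xs = allFin k} (All.tabulate λ _ → dom _))) length-allFin

  degree≤maxDegree : ∀ v → degree H v ≤ maxDegree H
  degree≤maxDegree v = All.lookup (xs≤max 0 (map (degree H) (allFin k))) (∈-map⁺ (degree H) (∈-allFin v))

  maxDegree≤k : maxDegree H ≤ k
  maxDegree≤k = max≤v⁺ {xs = map (degree H) (allFin k)} z≤n (All.map⁺ (All.tabulate λ {v} _ → degree≤k v))

  edge⇒homK₂ : ∀ {x y} → x ~ y → IsHom (K 2) H (lookup (x ∷ y ∷ []))
  edge⇒homK₂ x~y zero       zero       v≢v = contradiction refl v≢v
  edge⇒homK₂ x~y zero       (suc zero) _   = x~y
  edge⇒homK₂ x~y (suc zero) zero       _   = ~-sym x~y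
  edge⇒homK₂ x~y (suc zero) (suc zero) v≢v = contradiction refl v≢v

  -- Turns hypothesis (ii), stated with hom(K₂, H), into one on degrees: an ordered pair of adjacent
  -- colours is a colouring of K₂.
  degreeSum≤homK₂ : degreeSum H ≤ hom (K 2) H
  degreeSum≤homK₂ = begin
    sum (degree H)                                       ≡⟨ sum-cong-≗ (λ x → count≡sum (x ~?_)) ⟩
    sum (λ x → sum (λ y → ⟦ x ~? y ⟧))                   ≤⟨ sum-mono (λ x → sum-mono λ y → ⟦⟧-mono (x ~? y) (hom? x y) edge⇒homK₂) ⟩
    sum (λ x → sum (λ y → ⟦ hom? x y ⟧))                 ≡⟨ hom≡# (K 2) H ⟨
    hom (K 2) H                                          ∎
    where
    open ≤-Reasoning
    hom? : ∀ x y → Dec (IsHom (K 2) H (lookup (x ∷ y ∷ [])))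
    hom? x y = isHom? (K 2) H (lookup (x ∷ y ∷ []))

  count*d≤degreeSum : ∀ {X : Pred (Fin k) 0ℓ} (X? : Decidable X) {d} → (∀ x → X x → d ≤ degree H x) →
                      count X? * d ≤ degreeSum H
  count*d≤degreeSum X? {d} d≤degree = begin
    count X? * d                      ≡⟨ cong (_* d) (count≡sum X?) ⟩
    sum (λ x → ⟦ X? x ⟧) * d          ≡⟨ *-distribʳ-sum d (λ x → ⟦ X? x ⟧) ⟩
    sum (λ x → ⟦ X? x ⟧ * d)          ≤⟨ sum-mono pointwise ⟩
    sum (degree H)                    ∎
    where
    open ≤-Reasoning
    pointwise : ∀ x → ⟦ X? x ⟧ * d ≤ degree H x
    pointwise x with X? x
    ... | yes p = ≤-trans (≤-reflexive (*-identityˡ d)) (d≤degree x p)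
    ... | no _  = z≤n

  -- What the two hypotheses have in common. By `twins`, colours of maximum degree are
  -- interchangeable, so they can be placed independently on one side of a biclique.
  record Sparse : Set where
    field
      degreeSum<Δ² : degreeSum H < maxDegree H * maxDegree H
      top          : ∃[ d ] degree H d ≡ maxDegree H
      twins        : ∀ {d d′ x} → degree H d ≡ maxDegree H → degree H d′ ≡ maxDegree H → d ~ x → d′ ~ x

  -- A dominating vertex has degree `k`, so Δ = `k` and the vertices of maximum degree are the
  -- dominating ones. One missing adjacency puts the degree sum below k².
  dominating⇒sparse : ¬ (H ≅ Kˡᵒᵒᵖ (maxDegree H)) → ∃[ v ] LoopedDominating H v → Sparse
  dominating⇒sparse H≇K (v , dom) = record
    { degreeSum<Δ² = subst (λ Δ → degreeSum H < Δ * Δ) k≡Δ degreeSum<k²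
    ; top          = v , trans degree≡k k≡Δ
    ; twins        = λ {_} {d′} {x} _ degree-d′ _ → degree≡k⇒dominating (trans degree-d′ (sym k≡Δ)) x
    }
    where
    degree≡k : degree H v ≡ k
    degree≡k = dominating⇒degree≡k dom
    k≡Δ : k ≡ maxDegree H
    k≡Δ = ≤-antisym (≤-trans (≤-reflexive (sym degree≡k)) (degree≤maxDegree v)) maxDegree≤k
    degreeSum<k² : degreeSum H < k * k
    degreeSum<k² with any? (λ x → any? (λ y → ¬? (x ~? y)))
    ... | yes (x , y , x≁y) = subst (degreeSum H <_) (sum-const k) (sum-mono-< degree≤k x
      (≤∧≢⇒< (degree≤k x) λ full → x≁y (degree≡k⇒dominating full y)))
    -- With all adjacencies present, the identity is an isomorphism onto the looped complete graph.
    ... | no complete = contradiction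
      (subst (λ m → H ≅ Kˡᵒᵒᵖ m) k≡Δ (Perm.id , λ x y → mk⇔ (λ _ → tt) (λ _ → decidable-stable (x ~? y) λ x≁y → complete (x , y , x≁y))))
      H≇K

  uniqueTop⇒sparse : hom (K 2) H < maxDegree H ^ 2 → ∃! _≡_ (λ v → degree H v ≡ maxDegree H) → Sparse
  uniqueTop⇒sparse homK₂<Δ² (v , degree≡Δ , unique) = record
    { degreeSum<Δ² = ≤-<-trans degreeSum≤homK₂ (subst (hom (K 2) H <_) (cong (maxDegree H *_) (*-identityʳ _)) homK₂<Δ²)
    ; top          = v , degree≡Δ
    ; twins        = λ {d} {d′} {x} degree-d degree-d′ → subst (_~ x) (trans (sym (unique degree-d)) (unique degree-d′))
    }

module _ {m n k : ℕ} (G : SimpleGraph m) (G′ : SimpleGraph n) (H : Graph k) (π : Permutation m n)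
         (contains : ∀ {i j} → SimpleGraph._~_ G′ i j → SimpleGraph._~_ G (π ⟨$⟩ˡ i) (π ⟨$⟩ˡ j)) where
  private
    transport : Fin (k ^ m) → Fin (k ^ n)
    transport i = funToFin (finToFun i ∘ (π ⟨$⟩ˡ_))

    recover : ∀ i → finToFun {k} {n} (transport i) ∘ (π ⟨$⟩ʳ_) ≗ finToFun i
    recover i v = trans (finToFun-funToFin (finToFun i ∘ (π ⟨$⟩ˡ_)) (π ⟨$⟩ʳ v)) (cong (finToFun i) (Perm.inverseˡ π))

    funToFin-cong : ∀ {n} {f g : Fin n → Fin k} → f ≗ g → funToFin f ≡ funToFin g
    funToFin-cong {zero}  f≗g = refl
    funToFin-cong {suc n} f≗g = cong₂ combine (f≗g zero) (funToFin-cong (f≗g ∘ suc))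

    transport-injective : Injective _≡_ _≡_ transport
    transport-injective {i} {j} eq = begin
      i                       ≡⟨ funToFin-finToFin {m} {k} i ⟨
      funToFin (finToFun {k} {m} i)   ≡⟨ funToFin-cong (λ v → trans (sym (recover i v)) (trans (cong (λ z → finToFun {k} {n} z (π ⟨$⟩ʳ v)) eq) (recover j v))) ⟩
      funToFin (finToFun {k} {m} j)   ≡⟨ funToFin-finToFin {m} {k} j ⟩
      j                       ∎
      where open ≡-Reasoning

    transport-hom : ∀ i → IsHom G H (finToFun i) → IsHom G′ H (finToFun (transport i))
    transport-hom i hom = isHom-resp-≗ G′ H (sym ∘ finToFun-funToFin (finToFun i ∘ (π ⟨$⟩ˡ_)))
      λ v w v~w → hom (π ⟨$⟩ˡ v) (π ⟨$⟩ˡ w) (contains v~w)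

  -- `G` contains a copy of `G′` on all its vertices, so relabelling by `π` sends colourings of `G`
  -- injectively to colourings of `G′`.
  supergraph-hom-≤ : hom G H ≤ hom G′ H
  supergraph-hom-≤ = count-injective-≤ (isHom? G H ∘ finToFun) (isHom? G′ H ∘ finToFun) transport transport-injective transport-hom

  -- The colouring `f` of `G′` lies outside the image of this injection.
  supergraph-hom-< : ∀ {f} → IsHom G′ H f → ¬ IsHom G H (f ∘ (π ⟨$⟩ʳ_)) → hom G H < hom G′ H
  supergraph-hom-< {f} homG′ ¬homG =
    count-injective-< (isHom? G H ∘ finToFun) (isHom? G′ H ∘ finToFun) transport transport-injective transport-hom
      (funToFin f) (isHom-resp-≗ G′ H (sym ∘ finToFun-funToFin f) homG′)
      λ i homG eq → ¬homG (isHom-resp-≗ G H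
        (λ v → trans (sym (recover i v)) (trans (cong (λ z → finToFun {k} {n} z (π ⟨$⟩ʳ v)) eq) (finToFun-funToFin f (π ⟨$⟩ʳ v)))) homG)

K⟨⟩-hom : ∀ {a b k} (H : Graph k) {f : Fin a → Fin k} {g : Fin b → Fin k} →
          (∀ i j → Graph._~_ H (f i) (g j)) → IsHom K⟨ a , b ⟩ H ([ f , g ]′ ∘ splitAt a)
K⟨⟩-hom {a} H adjacent v w opposite with splitAt a v | splitAt a w
... | inj₁ i | inj₂ j = adjacent i j
... | inj₂ j | inj₁ i = Graph.~-sym H (adjacent i j)

module _ {k : ℕ} (H : Graph k) (sparse : Sparse H) where
  open Graph H
  open Sparse sparse

  private
    Δ = maxDegree H

  top? : Decidable (λ x → degree H x ≡ Δ)
  top? x = degree H x ≟ Δ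

  count-top*Δ≤degreeSum : count top? * Δ ≤ degreeSum H
  count-top*Δ≤degreeSum = count*d≤degreeSum H top? (λ _ eq → ≤-reflexive (sym eq))

  1≤count-top : 1 ≤ count top?
  1≤count-top = ∈-length (∈-filter⁺ top? (∈-allFin (proj₁ top)) (proj₂ top))

  -- From |D| Δ ≤ s < Δ² follows |D| < Δ, and D is nonempty.
  2≤Δ : 2 ≤ Δ
  2≤Δ = ≤-trans (s≤s 1≤count-top) (*-cancelʳ-< Δ _ _ (≤-<-trans count-top*Δ≤degreeSum degreeSum<Δ²))

  -- If the neighbourhood of `d` were a looped clique, its Δ members would each have degree at least
  -- Δ, and the degree sum would reach Δ².
  nonadjacent-neighbours : ∀ {d} → degree H d ≡ Δ → ∃[ x ] ∃[ y ] (x ~ d × y ~ d × ¬ (x ~ y))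
  nonadjacent-neighbours {d} degree-d
    with any? (λ x → any? (λ y → (x ~? d) ×-dec (y ~? d) ×-dec ¬? (x ~? y)))
  ... | yes found = found
  ... | no ¬found = contradiction degreeSum<Δ² (≤⇒≯ (≤-trans (≤-reflexive (cong (_* Δ) (sym degree-d)))
    (count*d≤degreeSum H (d ~?_) λ x d~x → ≤-trans (≤-reflexive (sym degree-d)) (count-mono (d ~?_) (x ~?_) λ y d~y →
      decidable-stable (x ~? y) λ x≁y → ¬found (x , y , ~-sym d~x , ~-sym d~y , x≁y)))))

  -- By `twins`, any colours of maximum degree on the first part fit with any neighbours of one
  -- fixed such colour on the second.
  K⟨⟩-lower-bound : ∀ a b → count top? ^ a * Δ ^ b ≤ hom K⟨ a , b ⟩ H
  K⟨⟩-lower-bound a b = begin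
    count top? ^ a * Δ ^ b              ≡⟨ cong (λ z → count top? ^ a * z ^ b) (proj₂ top) ⟨
    count top? ^ a * count (d ~?_) ^ b  ≤⟨ #-product a (λ f → isHom? K⟨ a , b ⟩ H (lookup f)) top? (d ~?_) (λ f g tops nbrs →
      isHom-resp-≗ K⟨ a , b ⟩ H (sym ∘ lookup-splitAt a f g) (K⟨⟩-hom H λ i j → twins (proj₂ top) (tops i) (nbrs j))) ⟩
    # (λ f → isHom? K⟨ a , b ⟩ H (lookup f))  ≡⟨ hom≡# K⟨ a , b ⟩ H ⟨
    hom K⟨ a , b ⟩ H                    ∎
    where
    open ≤-Reasoning
    d = proj₁ top

-- Bicliques

unique-lookup-injective : ∀ {A : Set} {xs : List A} → Unique xs → ∀ {i j} → List.lookup xs i ≡ List.lookup xs j → i ≡ j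
unique-lookup-injective (_    ∷ _) {zero}  {zero}  _  = refl
unique-lookup-injective (x≢xs ∷ _) {zero}  {suc j} eq = contradiction eq (All.lookup x≢xs (∈-lookup j))
unique-lookup-injective (x≢xs ∷ _) {suc i} {zero}  eq = contradiction (sym eq) (All.lookup x≢xs (∈-lookup i))
unique-lookup-injective (_    ∷ u) {suc i} {suc j} eq = cong suc (unique-lookup-injective u eq)

length-concatMap-≤ : ∀ {A B : Set} (f : A → List B) {c} xs → All (λ x → length (f x) ≤ c) xs →
                     length (concatMap f xs) ≤ length xs * c
length-concatMap-≤ f []       []           = z≤n
length-concatMap-≤ f (x ∷ xs) (fx≤c ∷ xs≤c) =
  ≤-trans (≤-reflexive (length-++ (f x))) (+-mono-≤ fx≤c (length-concatMap-≤ f xs xs≤c))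

module ListPartition {n : ℕ} {L R : List (Fin n)} (L-unique : Unique L) (R-unique : Unique R)
                 (∉L⇒∈R : ∀ {v} → v ∉ L → v ∈ R) (∈R⇒∉L : ∀ {v} → v ∈ R → v ∉ L) where

  private
    a = length L
    b = length R

  -- The decision is an argument, so that the inverse laws hold for any proof of membership and
  -- follow by cases.
  locate : ∀ v → Dec (v ∈ L) → Fin a ⊎ Fin b
  locate v (yes v∈L) = inj₁ (Any.index v∈L)
  locate v (no  v∉L) = inj₂ (Any.index (∉L⇒∈R v∉L))

  private
    element : Fin a ⊎ Fin b → Fin n
    element = [ List.lookup L , List.lookup R ]′

    element-locate : ∀ v (v∈?L : Dec (v ∈ L)) → element (locate v v∈?L) ≡ v
    element-locate v (yes v∈L) = sym (lookup-index v∈L)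
    element-locate v (no  v∉L) = sym (lookup-index (∉L⇒∈R v∉L))

    locate-element : ∀ s (d : Dec (element s ∈ L)) → locate (element s) d ≡ s
    locate-element (inj₁ i) (yes ∈L) = cong inj₁ (unique-lookup-injective L-unique (sym (lookup-index ∈L)))
    locate-element (inj₁ i) (no  ∉L) = contradiction (∈-lookup i) ∉L
    locate-element (inj₂ j) (yes ∈L) = contradiction ∈L (∈R⇒∉L (∈-lookup j))
    locate-element (inj₂ j) (no  ∉L) = cong inj₂ (unique-lookup-injective R-unique (sym (lookup-index (∉L⇒∈R ∉L))))

  split : Permutation n (a + b)
  split = permutation (λ v → join a b (locate v (v ∈ᶠ? L))) (element ∘ splitAt a)
    (λ i → trans (cong (join a b) (locate-element (splitAt a i) (_ ∈ᶠ? L))) (join-splitAt a b i))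
    (λ v → trans (cong element (splitAt-join a b (locate v (v ∈ᶠ? L)))) (element-locate v (v ∈ᶠ? L)))

  splitAt-split : ∀ v → splitAt a (split ⟨$⟩ʳ v) ≡ locate v (v ∈ᶠ? L)
  splitAt-split v = splitAt-join a b _

module _ {n k : ℕ} (G : SimpleGraph n) (H : Graph k) (sparse : Sparse H) where
  private
    module G = SimpleGraph G
    module H = Graph H

  -- `across` embeds the biclique in `G`, which gives the inequality. Equality excludes edges inside
  -- `L` and `outside` those avoiding `L`, so only the biclique is left.
  biclique-extremal : ∀ {L R : List (Fin n)} → Unique L → Unique R →
    (∀ {v} → v ∉ L → v ∈ R) → (∀ {v} → v ∈ R → v ∉ L) →
    (∀ {v w} → v ∈ L → w ∉ L → v G.~ w) → (∀ {v w} → v ∉ L → w ∉ L → ¬ (v G.~ w)) →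
    ∀ {a b} → length L ≡ a → length R ≡ b →
    (hom G H ≤ hom K⟨ a , b ⟩ H) × (hom G H ≡ hom K⟨ a , b ⟩ H → G.graph ≅ SimpleGraph.graph K⟨ a , b ⟩)
  biclique-extremal {L} {R} L-unique R-unique ∉L⇒∈R ∈R⇒∉L across outside refl refl =
    supergraph-hom-≤ G K⟨ a , b ⟩ H split contains , iso
    where
    open ListPartition L-unique R-unique ∉L⇒∈R ∈R⇒∉L
    a = length L
    b = length R
    module B = SimpleGraph K⟨ a , b ⟩

    contains : ∀ {i j} → i B.~ j → (split ⟨$⟩ˡ i) G.~ (split ⟨$⟩ˡ j)
    contains {i} {j} i~j with splitAt a i in eqᵢ | splitAt a j in eqⱼ
    ... | inj₁ x | inj₂ y = across (∈-lookup x) (∈R⇒∉L (∈-lookup y))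
    ... | inj₂ y | inj₁ x = G.~-sym (across (∈-lookup x) (∈R⇒∉L (∈-lookup y)))

    d = proj₁ (Sparse.top sparse)

    -- An edge vw inside L rules out the colouring of the biclique with the nonadjacent colours x at v and y elsewhere in L.
    inside-edge⇒< : ∀ {v w} → v ∈ L → w ∈ L → v G.~ w → hom G H < hom K⟨ a , b ⟩ H
    inside-edge⇒< {v} {w} v∈L w∈L v~w with nonadjacent-neighbours H sparse (proj₂ (Sparse.top sparse))
    ... | x , y , x~d , y~d , x≁y =
      supergraph-hom-< G K⟨ a , b ⟩ H split contains (K⟨⟩-hom H λ i _ → adjacent (List.lookup L i))
        λ hom → x≁y (subst₂ H._~_ (trans (on-L v∈L) at-v) (trans (on-L w∈L) (elsewhere w≢v)) (hom v w v~w))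
      where
      colour : Fin n → Fin k
      colour = lookup (Vec.replicate n y [ v ]≔ x)
      w≢v : w ≢ v
      w≢v w≡v = G.loopless (sym w≡v) v~w
      at-v : colour v ≡ x
      at-v = lookup∘update v (Vec.replicate n y) x
      elsewhere : ∀ {u} → u ≢ v → colour u ≡ y
      elsewhere {u} u≢v = trans (lookup∘update′ u≢v (Vec.replicate n y) x) (lookup-replicate u y)
      adjacent : ∀ u → colour u H.~ d
      adjacent u with u Fin.≟ v
      ... | yes refl = subst (H._~ d) (sym at-v) x~d
      ... | no  u≢v  = subst (H._~ d) (sym (elsewhere u≢v)) y~d
      on-L : ∀ {u} → u ∈ L → [ colour ∘ List.lookup L , (λ _ → d) ]′ (splitAt a (split ⟨$⟩ʳ u)) ≡ colour u
      on-L {u} u∈L rewrite splitAt-split u with u ∈ᶠ? L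
      ... | yes u∈L′ = cong colour (sym (lookup-index u∈L′))
      ... | no  u∉L  = contradiction u∈L u∉L

    iso : hom G H ≡ hom K⟨ a , b ⟩ H → G.graph ≅ SimpleGraph.graph K⟨ a , b ⟩
    iso eq = split , λ v w → mk⇔ (to v w) (λ i~j → subst₂ G._~_ (Perm.inverseˡ split) (Perm.inverseˡ split) (contains i~j))
      where
      to : ∀ v w → v G.~ w → (split ⟨$⟩ʳ v) B.~ (split ⟨$⟩ʳ w)
      to v w v~w rewrite splitAt-split v | splitAt-split w with v ∈ᶠ? L | w ∈ᶠ? L
      ... | yes v∈L | yes w∈L = contradiction eq (<⇒≢ (inside-edge⇒< v∈L w∈L v~w))
      ... | yes _   | no  _   = tt
      ... | no  _   | yes _   = tt
      ... | no  v∉L | no  w∉L = contradiction v~w (outside v∉L w∉L)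

-- The dichotomy for G

module _ {n : ℕ} (G : SimpleGraph n) where
  open SimpleGraph G

  neighbours : Fin n → List (Fin n)
  neighbours v = filter (v ~?_) (allFin n)

  neighbours-unique : ∀ v → Unique (neighbours v)
  neighbours-unique v = Unique.filter⁺ (v ~?_) (Unique.allFin⁺ n)

  ∈-neighbours⁺ : ∀ {v w} → v ~ w → w ∈ neighbours v
  ∈-neighbours⁺ {v} {w} = ∈-filter⁺ (v ~?_) (∈-allFin w)

  ∈-neighbours⁻ : ∀ {v w} → w ∈ neighbours v → v ~ w
  ∈-neighbours⁻ {v} w∈ = proj₂ (∈-filter⁻ (v ~?_) {xs = allFin n} w∈)

  degree<n : ∀ v → degree graph v < n
  degree<n v = unique⇒length≤ (unique-∷ (λ v∈ → loopless refl (∈-neighbours⁻ v∈)) (neighbours-unique v))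

  1≤degree⇒neighbour : ∀ {v} → 1 ≤ degree graph v → ∃[ w ] v ~ w
  1≤degree⇒neighbour {v} 1≤degree with any? (v ~?_)
  ... | yes found = found
  ... | no ¬found = contradiction (≤-trans 1≤degree (unique-⊆⇒length≤ {ys = []} (neighbours-unique v)
    λ w∈ → contradiction (_ , ∈-neighbours⁻ w∈) ¬found)) λ ()

  -- At most |S| T vertices are adjacent to a member of S of degree less than T, so some vertex outside the cover S avoids them all.
  cover⇒high-neighbourhood : ∀ {S T} → length S + length S * T < n → (∀ {v w} → v ~ w → v ∈ S ⊎ w ∈ S) →
                             ∃[ v ] (∀ {w} → v ~ w → T ≤ degree graph w)
  cover⇒high-neighbourhood {S} {T} small cover = v , high
    where
    low? : Decidable (λ w → degree graph w < T)
    low? w = degree graph w <? T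
    low : List (Fin n)
    low = filter low? S
    exceptional : List (Fin n)
    exceptional = S ++ concatMap neighbours low
    size : length exceptional ≤ length S + length S * T
    size = begin
      length exceptional                                    ≡⟨ length-++ S ⟩
      length S + length (concatMap neighbours low)          ≤⟨ +-monoʳ-≤ (length S) (length-concatMap-≤ neighbours low (All.map <⇒≤ (All.all-filter low? S))) ⟩
      length S + length low * T                             ≤⟨ +-monoʳ-≤ (length S) (*-monoˡ-≤ T (length-filter low? S)) ⟩
      length S + length S * T                               ∎
      where open ≤-Reasoning
    missing : ∃[ v ] v ∉ exceptional
    missing = length<⇒∃∉ exceptional (≤-<-trans size small)
    v = proj₁ missing
    high : ∀ {w} → v ~ w → T ≤ degree graph w
    high {w} v~w with cover v~w
    ... | inj₁ v∈S = contradiction (∈-++⁺ˡ v∈S) (proj₂ missing)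
    ... | inj₂ w∈S = ≮⇒≥ λ w-low → proj₂ missing (∈-++⁺ʳ S
      (∈-concatMap⁺ neighbours {xs = low} (Any.map (λ { refl → ∈-neighbours⁺ (~-sym v~w) }) (∈-filter⁺ low? w∈S w-low))))

module _ {n k : ℕ} (G : SimpleGraph n) (H : Graph k) where
  private
    module G = SimpleGraph G
    Δ = maxDegree H

  TopOn : List (Fin n) → Fin n → Pred (Fin k) 0ℓ
  TopOn L v x = v ∈ L → degree H x ≡ Δ

  topOn? : ∀ L v → Decidable (TopOn L v)
  topOn? L v x = (v ∈ᶠ? L) →-dec (degree H x ≟ Δ)

  NotTopAt : Fin n → Fin n → Pred (Fin k) 0ℓ
  NotTopAt a v x = v ≡ a → degree H x ≢ Δ

  notTopAt? : ∀ a v → Decidable (NotTopAt a v)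
  notTopAt? a v x = (v Fin.≟ a) →-dec ¬? (degree H x ≟ Δ)

  #topOn : List (Fin n) → ℕ
  #topOn L = # (PartialHom.colouredHom? G H (topOn? L))

  #notTopAt : Fin n → ℕ
  #notTopAt a = # (PartialHom.colouredHom? G H (notTopAt? a))

  -- A union bound: a colouring either uses only D on `L` or leaves D at some vertex of `L`. The
  -- induction splits off the failures at one vertex at a time.
  hom≤topOn+notTopAt : ∀ L {β} → (∀ {a} → a ∈ L → #notTopAt a ≤ β) → hom G H ≤ #topOn L + length L * β
  hom≤topOn+notTopAt L {β} bounded = ≤-trans (≤-reflexive (hom≡# G H)) (union L bounded)
    where
    open ≤-Reasoning
    union : ∀ L → (∀ {a} → a ∈ L → #notTopAt a ≤ β) → # (λ f → isHom? G H (lookup f)) ≤ #topOn L + length L * β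
    union [] _ = ≤-trans (#-mono (λ f → isHom? G H (lookup f)) (PartialHom.colouredHom? G H (topOn? [])) (λ f hom → (λ _ ()) , hom)) (m≤m+n _ 0)
    union (a ∷ L) bounded = begin
      # (λ f → isHom? G H (lookup f))                 ≤⟨ union L (bounded ∘ there) ⟩
      #topOn L + length L * β                         ≤⟨ +-monoˡ-≤ (length L * β) (#-∪ (PartialHom.colouredHom? G H (topOn? L))
                                                           (PartialHom.colouredHom? G H (topOn? (a ∷ L))) (PartialHom.colouredHom? G H (notTopAt? a)) dichotomy) ⟩
      #topOn (a ∷ L) + #notTopAt a + length L * β     ≤⟨ +-monoˡ-≤ (length L * β) (+-monoʳ-≤ (#topOn (a ∷ L)) (bounded (here refl))) ⟩
      #topOn (a ∷ L) + β + length L * β               ≡⟨ +-assoc (#topOn (a ∷ L)) β _ ⟩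
      #topOn (a ∷ L) + (β + length L * β)             ∎
      where
      dichotomy : ∀ f → PartialHom.ColouredHom G H (topOn? L) f →
                  PartialHom.ColouredHom G H (topOn? (a ∷ L)) f ⊎ PartialHom.ColouredHom G H (notTopAt? a) f
      dichotomy f (tops , hom) with degree H (lookup f a) ≟ Δ
      ... | yes top = inj₁ ((λ { v (here refl) → top ; v (there v∈L) → tops v v∈L }) , hom)
      ... | no ¬top = inj₂ ((λ { v refl → ¬top }) , hom)

  module _ (sparse : Sparse H) (1≤degree : ∀ v → 1 ≤ degree G.graph v) where
    open Sparse sparse

    private
      instance
        k≢0 : NonZero k
        k≢0 = Fin.nonZeroIndex (proj₁ top)

      total : ∀ {C : Fin n → Pred (Fin k) 0ℓ} (C? : ∀ v → Decidable (C v)) r {S N} → Unique S → length S + r ≡ n →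
              PartialHom.Bound G H C? S N → # (PartialHom.colouredHom? G H C?) ≤ N * Δ ^ r
      total C? = PartialHom.bound-total G H C? (degree≤maxDegree H) (<⇒≤ degreeSum<Δ²) (λ v → 1≤degree⇒neighbour G (1≤degree v))

    -- The star at `a` is coloured first: any colour of `a` outside D leaves at most `p` colours to
    -- each of `T` neighbours. The other vertices cost Δ each.
    notTopAt-bound : ∀ {a p T} → Δ ≡ suc p → T ≤ degree G.graph a → #notTopAt a ≤ p ^ T * k * Δ ^ (n ∸ (T + 1))
    notTopAt-bound {a} {p} {T} Δ≡1+p T≤degree = total (notTopAt? a) (n ∸ (T + 1)) unique size
        (subst (λ t → PartialHom.Bound G H (notTopAt? a) (M ++ a ∷ []) (p ^ t * k)) length-M
          (PartialHom.bound-star G H (notTopAt? a) degree≤p (Unique.take⁺ T (neighbours-unique G a)) M~a))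
      where
      M : List (Fin n)
      M = take T (neighbours G a)
      length-M : length M ≡ T
      length-M = trans (length-take T (neighbours G a)) (m≤n⇒m⊓n≡m T≤degree)
      M~a : All (G._~ a) M
      M~a = All.take⁺ T (All.map G.~-sym (All.all-filter (a G.~?_) (allFin n)))
      unique : Unique (M ++ a ∷ [])
      unique = Unique.++⁺ (Unique.take⁺ T (neighbours-unique G a)) ([] ∷ []) λ
        { (v∈M , here refl) → G.loopless refl (All.lookup M~a v∈M) }
      size : length (M ++ a ∷ []) + (n ∸ (T + 1)) ≡ n
      size = trans (cong (_+ (n ∸ (T + 1))) (trans (length-++ M) (cong (_+ 1) length-M)))
        (m+[n∸m]≡n (≤-trans (≤-reflexive (+-comm T 1)) (≤-<-trans T≤degree (degree<n G a))))
      degree≤p : ∀ x → NotTopAt a a x → degree H x ≤ p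
      degree≤p x ¬top = s≤s⁻¹ (≤-trans (≤∧≢⇒< (degree≤maxDegree H x) (¬top refl)) (≤-reflexive Δ≡1+p))

    -- Colour `L` from D, then the edge avoiding `L`, then the rest at Δ each. The gain lies in the
    -- edge, whose s colourings are fewer than Δ².
    topOn-bound : ∀ {L u v r} → Unique L → u ∉ v ∷ L → v ∉ L → u G.~ v → 2 + length L + r ≡ n →
                  #topOn L ≤ degreeSum H * count (top? H sparse) ^ length L * Δ ^ r
    topOn-bound {L} {u} {v} {r} unique u∉ v∉L u~v size =
      total (topOn? L) r (unique-∷ u∉ (unique-∷ v∉L unique)) size
        (PartialHom.bound-edge G H (topOn? L) u∉ v∉L u~v (PartialHom.bound-colours G H (topOn? L) unique count≡))
      where
      count≡ : ∀ {w} → w ∈ L → count (topOn? L w) ≡ count (top? H sparse)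
      count≡ {w} w∈L = ≤-antisym (count-mono (topOn? L w) (top? H sparse) (λ _ top → top w∈L))
                                 (count-mono (top? H sparse) (topOn? L w) (λ _ top _ → top))

    -- Either `m` disjoint edges are coloured first, or there is a cover so small that some vertex
    -- avoids it and the neighbourhoods of its members of low degree.
    matching-or-high-neighbourhood : ∀ m T → (m + m) + (m + m) * T < n →
      (∃[ r ] ((m + m) + r ≡ n × hom G H ≤ degreeSum H ^ m * Δ ^ r))
      ⊎ (∃[ v ] (∀ {w} → v G.~ w → T ≤ degree G.graph w))
    matching-or-high-neighbourhood m T small with PartialHom.matching-or-cover G H anyColour? m
      where
      anyColour? : ∀ (v : Fin n) → Decidable {A = Fin k} (λ _ → ⊤)
      anyColour? _ _ = yes tt
    ... | inj₂ (S , short , cover) =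
      inj₂ (cover⇒high-neighbourhood G (≤-<-trans (+-mono-≤ short (*-monoˡ-≤ T short)) small) cover)
    ... | inj₁ (S , unique , size , bound) =
      inj₁ (r , sizeᵣ , ≤-trans (≤-reflexive (hom≡# G H)) (≤-trans
        (#-mono (λ f → isHom? G H (lookup f)) (PartialHom.colouredHom? G H _) (λ f hom → (λ _ → tt) , hom))
        (total _ r unique (trans (cong (_+ r) size) sizeᵣ) bound)))
      where
      r = n ∸ (m + m)
      sizeᵣ : (m + m) + r ≡ n
      sizeᵣ = m+[n∸m]≡n (subst (_≤ n) size (unique⇒length≤ unique))

-- Extremality of the biclique

Extremal : ∀ {n k} → SimpleGraph n → Graph k → ℕ → Set
Extremal {n} G H δ = (hom G H ≤ hom K⟨ δ , n ∸ δ ⟩ H)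
  × (hom G H ≡ hom K⟨ δ , n ∸ δ ⟩ H → SimpleGraph.graph G ≅ SimpleGraph.graph K⟨ δ , n ∸ δ ⟩)

module _ {n k : ℕ} (G : SimpleGraph n) (H : Graph k) (sparse : Sparse H) where
  open Sparse sparse
  private
    module G = SimpleGraph G
    Δ = maxDegree H
    s = degreeSum H
    l = count (top? H sparse)

  -- The biclique has at least l^δ Δ^(n-δ) colourings, so the inequality is strict and equality
  -- cannot occur.
  <⇒extremal : ∀ {δ} → hom G H < l ^ δ * Δ ^ (n ∸ δ) → Extremal G H δ
  <⇒extremal {δ} hom< = <⇒≤ strict , λ eq → contradiction eq (<⇒≢ strict)
    where
    strict : hom G H < hom K⟨ δ , n ∸ δ ⟩ H
    strict = ≤-trans hom< (K⟨⟩-lower-bound H sparse δ (n ∸ δ))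

  -- A vertex outside `L` has all its neighbours in `L`; having at least δ of them, it is adjacent
  -- to all of `L`. So `G` contains the biclique.
  independent-complement⇒extremal : ∀ {δ L} → Unique L → length L ≡ δ → (∀ v → δ ≤ degree G.graph v) →
    (∀ {v w} → v ∉ L → w ∉ L → ¬ (v G.~ w)) → Extremal G H δ
  independent-complement⇒extremal {L = L} unique refl δ≤degree outside =
    biclique-extremal G H sparse unique R-unique
      (λ v∉L → ∈-filter⁺ ∉L? (∈-allFin _) v∉L) ∈R⇒∉L across outside refl length-R
    where
    ∉L? : Decidable (_∉ L)
    ∉L? v = ¬? (v ∈ᶠ? L)
    R : List (Fin n)
    R = filter ∉L? (allFin n)
    R-unique : Unique R
    R-unique = Unique.filter⁺ ∉L? (Unique.allFin⁺ n)
    ∈R⇒∉L : ∀ {v} → v ∈ R → v ∉ L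
    ∈R⇒∉L v∈R = proj₂ (∈-filter⁻ ∉L? {xs = allFin n} v∈R)
    length-L++R : length (L ++ R) ≡ n
    length-L++R = ≤-antisym (unique⇒length≤ (Unique.++⁺ unique R-unique λ (v∈L , v∈R) → ∈R⇒∉L v∈R v∈L))
      (≤-trans (≤-reflexive (sym length-allFin)) (unique-⊆⇒length≤ (Unique.allFin⁺ n) λ {v} _ → exhaustive v (v ∈ᶠ? L)))
      where
      exhaustive : ∀ v → Dec (v ∈ L) → v ∈ L ++ R
      exhaustive v (yes v∈L) = ∈-++⁺ˡ v∈L
      exhaustive v (no  v∉L) = ∈-++⁺ʳ L (∈-filter⁺ ∉L? (∈-allFin v) v∉L)
    length-R : length R ≡ n ∸ length L
    length-R = trans (sym (m+n∸m≡n (length L) (length R))) (cong (_∸ length L) (trans (sym (length-++ L)) length-L++R))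
    across : ∀ {v w} → v ∈ L → w ∉ L → v G.~ w
    -- Otherwise `v` and the neighbours of `w` would be more than δ distinct vertices of `L`.
    across {v} {w} v∈L w∉L = G.~-sym (decidable-stable (w G.~? v) λ w≁v →
      <⇒≱ (unique-⊆⇒length≤ (unique-∷ (w≁v ∘ ∈-neighbours⁻ G) (neighbours-unique G w)) λ
            { (here refl) → v∈L
            ; (there u∈)  → decidable-stable (_ ∈ᶠ? L) λ u∉L → outside w∉L u∉L (∈-neighbours⁻ G u∈) })
          (δ≤degree w))

  -- `L` consists of δ neighbours of `v`, all of high degree. An edge avoiding `L` makes the
  -- inequality strict; if there is none, the complement of `L` is independent.
  high-neighbourhood⇒extremal : ∀ {δ p t v} → Δ ≡ suc p → 1 ≤ δ → (∀ v → δ ≤ degree G.graph v) →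
    p ^ t * (k * (Δ * (Δ * Δ))) < suc p ^ t → (∀ {w} → v G.~ w → t * δ ≤ degree G.graph w) → Extremal G H δ
  high-neighbourhood⇒extremal {δ} {p} {t} {v} Δ≡1+p 1≤δ δ≤degree gap high
    with any? (λ u → any? (λ w → ¬? (u ∈ᶠ? L) ×-dec ¬? (w ∈ᶠ? L) ×-dec (u G.~? w)))
    where
    L : List (Fin n)
    L = take δ (neighbours G v)
  ... | no ¬edge = independent-complement⇒extremal (Unique.take⁺ δ (neighbours-unique G v))
    (trans (length-take δ (neighbours G v)) (m≤n⇒m⊓n≡m (δ≤degree v))) δ≤degree
    λ v∉L w∉L v~w → ¬edge (_ , _ , v∉L , w∉L , v~w)
  ... | yes (u , w , u∉L , w∉L , u~w) = <⇒extremal {δ} (begin-strict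
    hom G H                                              ≤⟨ hom≤topOn+notTopAt G H L {β} (λ {a} a∈L → notTopAt-bound G H sparse 1≤degree {a} {p} {t * δ} Δ≡1+p (L-high a∈L)) ⟩
    #topOn G H L + length L * β                          ≤⟨ +-monoˡ-≤ (length L * β) (topOn-bound G H sparse 1≤degree {L} {u} {w} {r} L-unique u∉ w∉L u~w size) ⟩
    s * l ^ length L * Δ ^ r + length L * β              ≡⟨ cong (λ z → s * l ^ z * Δ ^ r + z * β) length-L ⟩
    s * l ^ δ * Δ ^ r + δ * β                            <⟨ combined-gap {s} {l} {Δ} {δ} {n} {r} (1≤count-top H sparse) degreeSum<Δ² (trans (cong (λ z → 2 + z + r) (sym length-L)) size)
                                                              (avoiding-gap {Δ} {p} {k} {t} {δ} {r} {n ∸ (t * δ + 1)} Δ≡1+p (2≤Δ H sparse) 1≤k 1≤δ gap sizes) ⟩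
    l ^ δ * Δ ^ (n ∸ δ)                                  ∎)
    where
    open ≤-Reasoning
    L : List (Fin n)
    L = take δ (neighbours G v)
    L-unique : Unique L
    L-unique = Unique.take⁺ δ (neighbours-unique G v)
    length-L : length L ≡ δ
    length-L = trans (length-take δ (neighbours G v)) (m≤n⇒m⊓n≡m (δ≤degree v))
    L-high : ∀ {a} → a ∈ L → t * δ ≤ degree G.graph a
    L-high a∈L = high (All.lookup (All.take⁺ δ (All.all-filter (v G.~?_) (allFin n))) a∈L)
    1≤degree : ∀ v → 1 ≤ degree G.graph v
    1≤degree v = ≤-trans 1≤δ (δ≤degree v)
    1≤k : 1 ≤ k
    1≤k = ≤-trans (s≤s z≤n) (Fin.toℕ<n (proj₁ top))
    u∉ : u ∉ w ∷ L
    u∉ (here u≡w)  = G.loopless u≡w u~w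
    u∉ (there u∈L) = u∉L u∈L
    r = n ∸ (2 + length L)
    size : 2 + length L + r ≡ n
    size = m+[n∸m]≡n (unique⇒length≤ (unique-∷ u∉ (unique-∷ w∉L L-unique)))
    β = p ^ (t * δ) * k * Δ ^ (n ∸ (t * δ + 1))
    -- This neighbour of `v` has degree at least tδ, so tδ + 1 ≤ n and the subtraction in `sizes` is
    -- not truncated.
    v′ = 1≤degree⇒neighbour G (1≤degree v)
    sizes : t * δ + 1 + (n ∸ (t * δ + 1)) ≡ 2 + δ + r
    sizes = trans (m+[n∸m]≡n (≤-trans (≤-reflexive (+-comm (t * δ) 1)) (≤-<-trans (high (proj₂ v′)) (degree<n G (proj₁ v′)))))
                  (trans (sym size) (cong (λ z → 2 + z + r) length-L))

sparse⇒extremal : ∀ {k} (H : Graph k) → Sparse H →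
  ∃[ c ] (∀ δ n → 1 ≤ δ → c * δ ^ 2 ≤ n → (G : SimpleGraph n) → MinDegree (SimpleGraph.graph G) δ → Extremal G H δ)
-- The first gap fixes `e`, so that eδ disjoint edges suffice; the second fixes `t`, so that degree
-- tδ on `L` makes colours outside D negligible there.
sparse⇒extremal {k} H sparse = constant (exponential-gap s 1≤s Δ) (exponential-gap p 1≤p (k * (Δ * (Δ * Δ))))
  where
  open Sparse sparse
  Δ = maxDegree H
  s = degreeSum H
  l = count (top? H sparse)
  p = pred Δ
  1≤Δ : 1 ≤ Δ
  1≤Δ = ≤-trans (s≤s z≤n) (2≤Δ H sparse)
  Δ≡1+p : Δ ≡ suc p
  Δ≡1+p = sym (suc-pred Δ {{>-nonZero 1≤Δ}})
  1≤p : 1 ≤ p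
  1≤p = s≤s⁻¹ (≤-trans (2≤Δ H sparse) (≤-reflexive Δ≡1+p))
  1≤s : 1 ≤ s
  1≤s = ≤-trans (*-mono-≤ (1≤count-top H sparse) 1≤Δ) (count-top*Δ≤degreeSum H sparse)

  constant : ∃[ e ] s ^ e * Δ < suc s ^ e → ∃[ t ] p ^ t * (k * (Δ * (Δ * Δ))) < suc p ^ t →
             ∃[ c ] (∀ δ n → 1 ≤ δ → c * δ ^ 2 ≤ n → (G : SimpleGraph n) → MinDegree (SimpleGraph.graph G) δ → Extremal G H δ)
  -- The constant is that of `cover-small`, for covers of size 2eδ and threshold tδ. The vertex `v`
  -- gives δ < n, so n ∸ δ is the true difference.
  constant (e , matching) (t , star) = suc ((e + e) * suc t) , λ δ n 1≤δ cδ²≤n G (δ≤degree , v , _) →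
    [ (λ (r , size , hom≤) → many-edges δ n 1≤δ G (≤-trans (δ≤degree v) (<⇒≤ (degree<n G v))) r size hom≤)
    , (λ (u , high) → high-neighbourhood⇒extremal G H sparse {δ} {p} {t} {u} Δ≡1+p 1≤δ δ≤degree star high)
    ]′ (matching-or-high-neighbourhood G H sparse (λ v → ≤-trans 1≤δ (δ≤degree v)) (e * δ) (t * δ)
         (cover-small e t 1≤δ cδ²≤n))
    where
    open ≤-Reasoning
    many-edges : ∀ δ n → 1 ≤ δ → (G : SimpleGraph n) → δ ≤ n → ∀ r → e * δ + e * δ + r ≡ n →
                 hom G H ≤ s ^ (e * δ) * Δ ^ r → Extremal G H δ
    many-edges δ n 1≤δ G δ≤n r size hom≤ = <⇒extremal G H sparse {δ} (begin-strict
      hom G H                      ≤⟨ hom≤ ⟩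
      s ^ (e * δ) * Δ ^ r          <⟨ matching-gap {s} {Δ} {e} {δ} {n} {r} 1≤Δ degreeSum<Δ² matching 1≤δ δ≤n size ⟩
      -- D is nonempty, so its factor l^δ is at least 1.
      Δ ^ (n ∸ δ)                  ≤⟨ m≤n*m (Δ ^ (n ∸ δ)) (l ^ δ) {{m^n≢0 l δ {{>-nonZero (1≤count-top H sparse)}}}} ⟩
      l ^ δ * Δ ^ (n ∸ δ)          ∎)

corollary1p7 : ∀ {k} (H : Graph k) →
    (∀ v → ¬ Isolated H v) →
    ((¬ (H ≅ Kˡᵒᵒᵖ (maxDegree H)) × ∃[ v ] LoopedDominating H v)
    ⊎ (hom (K 2) H < maxDegree H ^ 2 × ∃! _≡_ (λ v → degree H v ≡ maxDegree H))) →
    ∃[ c ] (∀ δ n → 1 ≤ δ → c * δ ^ 2 ≤ n →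
    (G : SimpleGraph n) → MinDegree (SimpleGraph.graph G) δ →
    (hom G H ≤ hom K⟨ δ , n ∸ δ ⟩ H)
    × (hom G H ≡ hom K⟨ δ , n ∸ δ ⟩ H → SimpleGraph.graph G ≅ SimpleGraph.graph K⟨ δ , n ∸ δ ⟩))
corollary1p7 H _ (inj₁ (H≇K , dominating))    = sparse⇒extremal H (dominating⇒sparse H H≇K dominating)
corollary1p7 H _ (inj₂ (homK₂<Δ² , uniqueTop)) = sparse⇒extremal H (uniqueTop⇒sparse H homK₂<Δ² uniqueTop)
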